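{- Let $\mathbf{V}$ be a variety of Heyting algebras such that the variety $\rho^*(\mathbf{V})$ of interior algebras generated by $\{\mathcal{B}(L): L \in \mathbf{V}\}$ is locally finite. Then for every $L \in \mathbf{V}$, the unification type of $L$ in $\mathbf{V}$ equals the unification type of $\mathcal{B}(L)$ in $\rho^*(\mathbf{V})$, i.e. $t^{\mathbf{V}}(L) = t^{\rho^*(\mathbf{V})}(\mathcal{B}(L))$.
   Context: An interior algebra is a Boolean algebra $B$ with an operator $g$ satisfying $g(1)=1$, $g(x\cdot y)=g(x)\cdot g(y)$, $g(x)\le x$, $g(g(x))=g(x)$. For a Heyting algebra $L$, $\mathcal{B}(L)$ is the interior algebra $\langle \mathrm{Fr}(L), g_L\rangle$, where $\mathrm{Fr}(L)$ is the free (minimal) Boolean extension of the bounded lattice $L$ (so every element has the form $(-u_1+v_1)\cdots(-u_n+v_n)$ with $u_i,v_i\in L$) and $g_L((-u_1+v_1)\cdots(-u_n+v_n)) = (u_1\Rightarrow v_1)\cdots(u_n\Rightarrow v_n)$; its open elements form a Heyting algebra isomorphic to $L$. Unification: for a variety $\mathbf{W}$ and a finitely presented $A\in\mathbf{W}$, a unifier of $A$ in $\mathbf{W}$ is a pair $\langle u,B\rangle$ with $B$ finitely presented and projective in $\mathbf{W}$ and $u\colon A\to B$ a homomorphism; $\langle u,B\rangle \succcurlyeq \langle v,C\rangle$ iff there is a homomorphism $h\colon B\to C$ with $v = h\circ u$. This is a quasiorder on the set $U^{\mathbf{W}}_A$ of unifiers. A $\mu$-set of a quasiordered set is a dense antichain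 (every element lies below some element of it). The unification type $t^{\mathbf{W}}(A)$ is $1$ if $U_A^{\mathbf{W}}$ has a $\mu$-set of cardinality $1$, $\omega$ if it has a finite $\mu$-set of cardinality $>1$, $\infty$ if it has an infinite $\mu$-set, and $0$ if it has no $\mu$-set. -}

module Defs where

import Algebra.Lattice.Bundles as Alg
import Algebra.Lattice.Properties.BooleanAlgebra as BooleanProperties
import Algebra.Lattice.Structures as AlgStructures
import Algebra.Lattice.Structures.Biased as Biased
import Relation.Binary.Construct.NaturalOrder.Left as NaturalOrder
import Relation.Binary.Lattice.Properties.HeytingAlgebra as HeytingProperties
import Relation.Binary.Lattice.Properties.JoinSemilattice as JoinProperties
import Relation.Binary.Lattice.Properties.Lattice as OrderLatticeProperties
import Relation.Binary.Lattice.Properties.MeetSemilattice as MeetProperties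
import Relation.Binary.Reasoning.Setoid as SetoidReasoning
open import Data.Fin.Base using (Fin; zero; suc)
open import Data.List.Base using (List; []; _∷_; _++_; map; cartesianProductWith)
open import Data.List.Properties using (++-assoc)
open import Data.List.Relation.Unary.All as All using (All; []; _∷_)
open import Data.List.Relation.Unary.All.Properties using (++⁺; ++⁻ˡ; ++⁻ʳ; map⁺; map⁻)
open import Data.Nat.Base using (ℕ; _<_)
open import Data.Product.Base using (Σ-syntax; ∃-syntax; _×_; _,_; proj₁; proj₂)
open import Data.Vec.Functional as Vec using (Vector)
open import Function.Bundles using (Surjection)
open import Function.Definitions using (StrictlySurjective)
open import Level using (Level; 0ℓ; _⊔_) renaming (suc to lsuc)
open import Relation.Binary.Bundles using (Setoid)
open import Relation.Binary.Lattice using (HeytingAlgebra; Lattice; IsHeytingAlgebra)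
open import Relation.Binary.PropositionalEquality as ≡ using (_≡_)
open import Relation.Binary.Structures using (IsEquivalence)
open import Relation.Nullary using (¬_)
open import Relation.Unary using (Pred)

private
  variable
    ℓ ℓ′ : Level

record Signature : Set₁ where
  field
    Op    : Set
    arity : Op → ℕ

open Signature

record Algebra (S : Signature) : Set₁ where
  infix 4 _≈_
  field
    Carrier       : Set
    _≈_           : Carrier → Carrier → Set
    isEquivalence : IsEquivalence _≈_
    interp        : (f : Op S) → Vector Carrier (arity S f) → Carrier
    interp-cong   : ∀ f {xs ys} → (∀ i → xs i ≈ ys i) → interp f xs ≈ interp f ys

  setoid : Setoid 0ℓ 0ℓ
  setoid = record { isEquivalence = isEquivalence }

data Term (S : Signature) (X : Set) : Set where
  var : X → Term S X
  op  : (f : Op S) → Vector (Term S X) (arity S f) → Term S X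

Equation : Signature → Set → Set
Equation S X = Term S X × Term S X

eval : ∀ {S X} (A : Algebra S) → (X → Algebra.Carrier A) → Term S X → Algebra.Carrier A
eval A ρ (var x)   = ρ x
eval A ρ (op f ts) = Algebra.interp A f (λ i → eval A ρ (ts i))

Holds : ∀ {S X} (A : Algebra S) → (X → Algebra.Carrier A) → Equation S X → Set
Holds A ρ (s , t) = Algebra._≈_ A (eval A ρ s) (eval A ρ t)

-- A variety is the class of models of a set of identities.

Variety : Signature → Set₂
Variety S = Pred (Equation S ℕ) (lsuc 0ℓ)

infix 4 _∈ᵥ_

_∈ᵥ_ : ∀ {S} → Algebra S → Variety S → Set₁
A ∈ᵥ W = ∀ e → W e → ∀ ρ → Holds A ρ e

-- The least variety containing every A i: an algebra belongs to all
-- equational classes that contain the family exactly when it satisfies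
-- all identities valid throughout the family.

Generated : ∀ {S} {I : Set₁} → (I → Algebra S) → Variety S
Generated A e = ∀ i ρ → Holds (A i) ρ e

Generated-contains : ∀ {S} {I : Set₁} (A : I → Algebra S) → ∀ i → A i ∈ᵥ Generated A
Generated-contains A i e valid = valid i

Generated-least : ∀ {S} {I : Set₁} (A : I → Algebra S) (W : Variety S) →
                  (∀ i → A i ∈ᵥ W) → ∀ B → B ∈ᵥ Generated A → B ∈ᵥ W
Generated-least A W A∈W B B∈ e e∈W = B∈ e (λ i → A∈W i e e∈W)

Finite : Setoid ℓ ℓ′ → Set (ℓ ⊔ ℓ′)
Finite X = ∃[ n ] Surjection (≡.setoid (Fin n)) X

FinitelyGenerated : ∀ {S} → Algebra S → Set
FinitelyGenerated A =
  ∃[ n ] Σ[ a ∈ (Fin n → Carrier) ] (∀ x → ∃[ t ] eval A a t ≈ x)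
  where open Algebra A

LocallyFinite : ∀ {S} → Variety S → Set₁
LocallyFinite W = ∀ A → A ∈ᵥ W → FinitelyGenerated A → Finite (Algebra.setoid A)

record Hom {S : Signature} (A B : Algebra S) : Set where
  private
    module A = Algebra A
    module B = Algebra B
  field
    ⟦_⟧  : A.Carrier → B.Carrier
    cong : ∀ {x y} → x A.≈ y → ⟦ x ⟧ B.≈ ⟦ y ⟧
    homo : ∀ f xs → ⟦ A.interp f xs ⟧ B.≈ B.interp f (λ i → ⟦ xs i ⟧)

open Hom using (⟦_⟧)

-- A is the W-algebra presented by finitely many generators and relations,
-- i.e. A has the universal property of the quotient of the W-free algebra
-- on Fin n by the congruence generated by the listed pairs.

record FinitelyPresented {S : Signature} (W : Variety S) (A : Algebra S)
       : Set₁ where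
  open Algebra A using (Carrier)
  field
    n                   : ℕ
    relations           : List (Equation S (Fin n))
    generators          : Fin n → Carrier
    generators-satisfy  : All (Holds A generators) relations
    extend              : ∀ B → B ∈ᵥ W → (b : Fin n → Algebra.Carrier B) →
                          All (Holds B b) relations →
                          Σ[ h ∈ Hom A B ] (∀ i → Algebra._≈_ B (⟦ h ⟧ (generators i)) (b i))
    extend-unique       : ∀ B → B ∈ᵥ W → (h k : Hom A B) →
                          (∀ i → Algebra._≈_ B (⟦ h ⟧ (generators i)) (⟦ k ⟧ (generators i))) →
                          ∀ x → Algebra._≈_ B (⟦ h ⟧ x) (⟦ k ⟧ x)

Projective : ∀ {S} → Variety S → Algebra S → Set₁
Projective W P =
  ∀ C D → C ∈ᵥ W → D ∈ᵥ W → (f : Hom C D) → StrictlySurjective (Algebra._≈_ D) ⟦ f ⟧ →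
  (h : Hom P D) → Σ[ k ∈ Hom P C ] (∀ x → Algebra._≈_ D (⟦ f ⟧ (⟦ k ⟧ x)) (⟦ h ⟧ x))

record Unifier {S : Signature} (W : Variety S) (A : Algebra S) : Set₁ where
  field
    target             : Algebra S
    target∈W           : target ∈ᵥ W
    finitelyPresented  : FinitelyPresented W target
    projective         : Projective W target
    hom                : Hom A target

infix 4 _≽_

_≽_ : ∀ {S} {W : Variety S} {A : Algebra S} → Unifier W A → Unifier W A → Set
U ≽ V = Σ[ h ∈ Hom U.target V.target ]
          (∀ x → Algebra._≈_ V.target (⟦ V.hom ⟧ x) (⟦ h ⟧ (⟦ U.hom ⟧ x)))
  where
  module U = Unifier U
  module V = Unifier V

-- A μ-set, enumerated by I.  By antichain the enumeration is injective,
-- so the cardinality of the μ-set is that of I.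

record IsMuSet {S : Signature} {W : Variety S} {A : Algebra S}
               {I : Set ℓ} (m : I → Unifier W A) : Set (lsuc 0ℓ ⊔ ℓ) where
  field
    antichain : ∀ i j → m i ≽ m j → i ≡ j
    dense     : ∀ U → ∃[ i ] m i ≽ U

data UnificationType : Set where
  unitary finitary infinitary nullary : UnificationType   -- 1, ω, ∞, 0

-- HasType W A τ says t^W(A) = τ.  Infinite index types range over Set₁, the
-- universe of Unifier W A, so every subset of the set of unifiers is covered.

module _ {S : Signature} (W : Variety S) (A : Algebra S) where

  HasMuSet : Set ℓ → Set (lsuc 0ℓ ⊔ ℓ)
  HasMuSet I = Σ[ m ∈ (I → Unifier W A) ] IsMuSet m

  data HasType : UnificationType → Set₂ where
    is-1 : HasMuSet (Fin 1) → HasType unitary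
    is-ω : ∀ n → 1 < n → HasMuSet (Fin n) → HasType finitary
    is-∞ : ∀ (I : Set₁) → ¬ Finite (≡.setoid I) → HasMuSet I → HasType infinitary
    is-0 : (∀ (I : Set₁) → ¬ HasMuSet I) → HasType nullary

data HeytingOp : Set where
  or and imp top bot : HeytingOp

heytingSignature : Signature
heytingSignature = record
  { Op    = HeytingOp
  ; arity = λ { or → 2 ; and → 2 ; imp → 2 ; top → 0 ; bot → 0 }
  }

module HeytingOperations (A : Algebra heytingSignature) where
  open Algebra A

  _∨_ _∧_ _⇒_ : Carrier → Carrier → Carrier
  x ∨ y = interp or  (x Vec.∷ y Vec.∷ Vec.[])
  x ∧ y = interp and (x Vec.∷ y Vec.∷ Vec.[])
  x ⇒ y = interp imp (x Vec.∷ y Vec.∷ Vec.[])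

  ⊤ ⊥ : Carrier
  ⊤ = interp top Vec.[]
  ⊥ = interp bot Vec.[]

  _≤_ : Carrier → Carrier → Set
  _≤_ = NaturalOrder._≤_ _≈_ _∧_

IsHeyting : Algebra heytingSignature → Set
IsHeyting A = IsHeytingAlgebra _≈_ _≤_ _∨_ _∧_ _⇒_ ⊤ ⊥
  where
  open Algebra A
  open HeytingOperations A

asHeytingAlgebra : (A : Algebra heytingSignature) → IsHeyting A → HeytingAlgebra 0ℓ 0ℓ 0ℓ
asHeytingAlgebra A isHeyting = record { isHeytingAlgebra = isHeyting }

VarietyOfHeytingAlgebras : Variety heytingSignature → Set₁
VarietyOfHeytingAlgebras V = ∀ A → A ∈ᵥ V → IsHeyting A

record InteriorAlgebra : Set₁ where
  field
    booleanAlgebra : Alg.BooleanAlgebra 0ℓ 0ℓ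
  open Alg.BooleanAlgebra booleanAlgebra hiding (¬_)
  field
    g            : Carrier → Carrier
    g-cong       : ∀ {x y} → x ≈ y → g x ≈ g y
    g-⊤          : g ⊤ ≈ ⊤
    g-∧          : ∀ x y → g (x ∧ y) ≈ g x ∧ g y
    g-decreasing : ∀ x → NaturalOrder._≤_ _≈_ _∧_ (g x) x
    g-idempotent : ∀ x → g (g x) ≈ g x

data InteriorOp : Set where
  or and neg top bot int : InteriorOp

interiorSignature : Signature
interiorSignature = record
  { Op    = InteriorOp
  ; arity = λ { or → 2 ; and → 2 ; neg → 1 ; top → 0 ; bot → 0 ; int → 1 }
  }

asAlgebra : InteriorAlgebra → Algebra interiorSignature
asAlgebra B = record
  { Carrier       = Carrier
  ; _≈_           = _≈_
  ; isEquivalence = isEquivalence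
  ; interp        = λ
    { or  xs → xs zero ∨ xs (suc zero)
    ; and xs → xs zero ∧ xs (suc zero)
    ; neg xs → - xs zero
    ; top xs → ⊤
    ; bot xs → ⊥
    ; int xs → g (xs zero)
    }
  ; interp-cong   = λ
    { or  p → ∨-cong (p zero) (p (suc zero))
    ; and p → ∧-cong (p zero) (p (suc zero))
    ; neg p → ¬-cong (p zero)
    ; top p → refl
    ; bot p → refl
    ; int p → g-cong (p zero)
    }
  }
  where
  open InteriorAlgebra B
  open Alg.BooleanAlgebra booleanAlgebra renaming (¬_ to -_)

module FreeBooleanExtension (L : HeytingAlgebra 0ℓ 0ℓ 0ℓ) where
  open HeytingAlgebra L
  open HeytingProperties L
    using (∧-distribˡ-∨-≤; ⇨-eval)
  open JoinProperties joinSemilattice using (∨-monotonic)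
  open MeetProperties meetSemilattice using (∧-monotonic)

  -- The list (u₁ , v₁) ∷ … ∷ (uₙ , vₙ) ∷ [] denotes (-u₁ + v₁) ⋯ (-uₙ + vₙ).

  Fr : Set
  Fr = List (Carrier × Carrier)

  -- Entails x s t expresses x · s ≤ t in the free Boolean extension, using
  --   (-u + v) · x · s ≤ t   iff   x · s ≤ t + u  and  x · (s · v) ≤ t.

  Entails : Fr → Carrier → Carrier → Set
  Entails []            s t = s ≤ t
  Entails ((u , v) ∷ x) s t = Entails x s (t ∨ u) × Entails x (s ∧ v) t

  infix 4 _≼_ _≋_

  record _≼_ (x y : Fr) : Set where
    constructor ⟪_⟫
    field
      entails : All (λ (s , t) → Entails x s t) y

  open _≼_

  _≋_ : Fr → Fr → Set
  x ≋ y = x ≼ y × y ≼ x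

  ι : Carrier → Fr
  ι a = (⊤ , a) ∷ []

  1# 0# : Fr
  1# = []
  0# = (⊤ , ⊥) ∷ []

  infixr 6 _+_
  infixr 7 _·_
  infix  8 -_

  _·_ : Fr → Fr → Fr
  _·_ = _++_

  -- (-u + v) + (-s + t) = -(u ∧ s) + (v ∨ t), extended by distributivity.

  _+_ : Fr → Fr → Fr
  _+_ = cartesianProductWith (λ (u , v) (s , t) → u ∧ s , v ∨ t)

  -- -((-u + v) · x) = u · (-v) + -x

  -_ : Fr → Fr
  - []            = 0#
  - ((u , v) ∷ x) = ((⊤ , u) ∷ (v , ⊥) ∷ []) + - x

  -- ⋀ᵢ (uᵢ ⇒ vᵢ), computed in L

  interior : Fr → Carrier
  interior []            = ⊤
  interior ((u , v) ∷ x) = (u ⇨ v) ∧ interior x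

  g : Fr → Fr
  g x = ι (interior x)

  Entails-mono : ∀ x {s s′ t t′} → s′ ≤ s → t ≤ t′ → Entails x s t → Entails x s′ t′
  Entails-mono []            p q e       = trans p (trans e q)
  Entails-mono ((u , v) ∷ x) p q (e , f) =
    Entails-mono x p (∨-monotonic q refl) e , Entails-mono x (∧-monotonic p refl) q f

  ≤⇒Entails : ∀ x {s t} → s ≤ t → Entails x s t
  ≤⇒Entails []            p = p
  ≤⇒Entails ((u , v) ∷ x) p =
    ≤⇒Entails x (trans p (x≤x∨y _ _)) , ≤⇒Entails x (trans (x∧y≤x _ _) p)

  Entails-∷ : ∀ c x {s t} → Entails x s t → Entails (c ∷ x) s t
  Entails-∷ c x e = Entails-mono x refl (x≤x∨y _ _) e , Entails-mono x (x∧y≤x _ _) refl e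

  Entails-cut : ∀ x {s t} u → Entails x s (t ∨ u) → Entails x (s ∧ u) t → Entails x s t
  Entails-cut []            u e f =
    trans (∧-greatest refl e)
      (trans (∧-distribˡ-∨-≤ _ _ _) (∨-least (x∧y≤y _ _) f))
  Entails-cut ((p , q) ∷ x) u (e₁ , e₂) (f₁ , f₂) =
    Entails-cut x u
      (Entails-mono x refl
        (∨-least (∨-least (trans (x≤x∨y _ _) (x≤x∨y _ _)) (y≤x∨y _ _))
                 (trans (y≤x∨y _ _) (x≤x∨y _ _))) e₁)
      f₁ ,
    Entails-cut x u e₂
      (Entails-mono x (∧-greatest (∧-monotonic (x∧y≤x _ _) refl)
                                  (trans (x∧y≤x _ _) (x∧y≤y _ _))) refl f₂)

  Entails-step : ∀ x {s t} u v → Entails x u v →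
                 Entails x s (t ∨ u) → Entails x (s ∧ v) t → Entails x s t
  Entails-step x u v c e f = Entails-cut x u e
    (Entails-cut x v (Entails-mono x (x∧y≤y _ _) (y≤x∨y _ _) c)
                     (Entails-mono x (∧-monotonic (x∧y≤x _ _) refl) refl f))

  Entails-trans : ∀ x {y s t} → x ≼ y → Entails y s t → Entails x s t
  Entails-trans x {[]}          ⟪ [] ⟫    e       = ≤⇒Entails x e
  Entails-trans x {(u , v) ∷ y} ⟪ c ∷ p ⟫ (e , f) =
    Entails-step x u v c (Entails-trans x ⟪ p ⟫ e) (Entails-trans x ⟪ p ⟫ f)

  ≼-refl : ∀ x → x ≼ x
  ≼-refl []            = ⟪ [] ⟫
  ≼-refl ((u , v) ∷ x) = ⟪
    (≤⇒Entails x (y≤x∨y _ _) , ≤⇒Entails x (x∧y≤y _ _)) ∷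
    All.map (Entails-∷ (u , v) x) (entails (≼-refl x)) ⟫

  ≼-trans : ∀ {x y z} → x ≼ y → y ≼ z → x ≼ z
  ≼-trans {x} p ⟪ q ⟫ = ⟪ All.map (Entails-trans x p) q ⟫

  ·-infimum : ∀ x y → x · y ≼ x × x · y ≼ y × (∀ z → z ≼ x → z ≼ y → z ≼ x · y)
  ·-infimum x y =
    ⟪ ++⁻ˡ x (entails (≼-refl (x ++ y))) ⟫ ,
    ⟪ ++⁻ʳ x (entails (≼-refl (x ++ y))) ⟫ ,
    λ z p q → ⟪ ++⁺ (entails p) (entails q) ⟫

  pairs⁺ : ∀ {P : Pred (Carrier × Carrier) 0ℓ} x y →
           All (λ (u , v) → All (λ (s , t) → P (u ∧ s , v ∨ t)) y) x → All P (x + y)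
  pairs⁺ []      y []       = []
  pairs⁺ (c ∷ x) y (p ∷ ps) = ++⁺ (map⁺ p) (pairs⁺ x y ps)

  pairs⁻ : ∀ {P : Pred (Carrier × Carrier) 0ℓ} x y →
           All P (x + y) → All (λ (u , v) → All (λ (s , t) → P (u ∧ s , v ∨ t)) y) x
  pairs⁻ []      y []       = []
  pairs⁻ (c ∷ x) y ps = map⁻ (++⁻ˡ (map _ y) ps) ∷ pairs⁻ x y (++⁻ʳ (map _ y) ps)

  Entails-pairs : ∀ z y {a b} u v → All (λ (s , t) → Entails z (u ∧ s) (v ∨ t)) y →
                  Entails y a b → Entails z (u ∧ a) (v ∨ b)
  Entails-pairs z []            u v []       e       =
    ≤⇒Entails z (trans (x∧y≤y _ _) (trans e (y≤x∨y _ _)))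
  Entails-pairs z ((s , t) ∷ y) u v (c ∷ cs) (e , f) =
    Entails-step z (u ∧ s) (v ∨ t) c
      (Entails-cut z s
        (Entails-mono z refl
          (∨-least (trans (x≤x∨y _ _) (trans (x≤x∨y _ _) (x≤x∨y _ _)))
            (∨-least (trans (y≤x∨y _ _) (trans (x≤x∨y _ _) (x≤x∨y _ _))) (y≤x∨y _ _)))
          (Entails-pairs z y u v cs e))
        (≤⇒Entails z (trans (∧-monotonic (x∧y≤x _ _) refl) (y≤x∨y _ _))))
      (Entails-cut z t
        (≤⇒Entails z (trans (x∧y≤y _ _)
          (∨-least (trans (x≤x∨y _ _) (x≤x∨y _ _)) (y≤x∨y _ _))))
        (Entails-mono z
          (∧-greatest (trans (x∧y≤x _ _) (trans (x∧y≤x _ _) (x∧y≤x _ _)))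
            (∧-greatest (trans (x∧y≤x _ _) (trans (x∧y≤x _ _) (x∧y≤y _ _))) (x∧y≤y _ _)))
          refl
          (Entails-pairs z y u v cs f)))

  +-supremum : ∀ x y → x ≼ x + y × y ≼ x + y × (∀ z → x ≼ z → y ≼ z → x + y ≼ z)
  +-supremum x y =
    ⟪ pairs⁺ x y (All.map (λ e → All.universal
        (λ _ → Entails-mono x (x∧y≤x _ _) (x≤x∨y _ _) e) y) (entails (≼-refl x))) ⟫ ,
    ⟪ pairs⁺ x y (All.universal (λ _ → All.map
        (Entails-mono y (x∧y≤y _ _) (y≤x∨y _ _)) (entails (≼-refl y))) x) ⟫ ,
    λ z p q → ⟪ All.zipWith (λ (e , f) → least e f) (entails p , entails q) ⟫
    where
    least : ∀ {a b} → Entails x a b → Entails y a b → Entails (x + y) a b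
    least {a} {b} e f =
      Entails-mono (x + y) (∧-greatest refl refl) (∨-least refl refl)
        (Entails-pairs (x + y) x a b
          (All.map (λ {(u , v)} cs →
             Entails-mono (x + y)
               (∧-greatest (x∧y≤y _ _) (x∧y≤x _ _)) (∨-least (y≤x∨y _ _) (x≤x∨y _ _))
               (Entails-pairs (x + y) y u v cs f))
            (pairs⁻ x y (entails (≼-refl (x + y)))))
          e)

  ≋-isEquivalence : IsEquivalence _≋_
  ≋-isEquivalence = record
    { refl  = ≼-refl _ , ≼-refl _
    ; sym   = λ (p , q) → q , p
    ; trans = λ (p , q) (r , s) → ≼-trans p r , ≼-trans s q
    }

  Fr-lattice : Lattice 0ℓ 0ℓ 0ℓ
  Fr-lattice = record
    { Carrier = Fr ; _≈_ = _≋_ ; _≤_ = _≼_ ; _∨_ = _+_ ; _∧_ = _·_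
    ; isLattice = record
      { isPartialOrder = record
        { isPreorder = record
          { isEquivalence = ≋-isEquivalence ; reflexive = proj₁ ; trans = ≼-trans }
        ; antisym = _,_
        }
      ; supremum = +-supremum
      ; infimum  = ·-infimum
      }
    }

  +-distribʳ-· : ∀ z x y → (x · y) + z ≡ (x + z) · (y + z)
  +-distribʳ-· z []      y = ≡.refl
  +-distribʳ-· z (c ∷ x) y =
    ≡.trans (≡.cong (map _ z ++_) (+-distribʳ-· z x y)) (≡.sym (++-assoc (map _ z) (x + z) (y + z)))

  isDistributiveLattice : AlgStructures.IsDistributiveLattice _≋_ _+_ _·_
  isDistributiveLattice = Biased.isDistributiveLatticeʳʲᵐ record
    { isLattice    = OrderLatticeProperties.isAlgLattice Fr-lattice
    ; ∨-distribʳ-∧ = λ z x y → IsEquivalence.reflexive ≋-isEquivalence (+-distribʳ-· z x y)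
    }

  open AlgStructures.IsDistributiveLattice isDistributiveLattice
    using (∧-distribˡ-∨)
  open Lattice Fr-lattice
    using () renaming (x≤x∨y to x≼x+y; y≤x∨y to y≼x+y; ∨-least to +-least;
                       x∧y≤x to x·y≼x; x∧y≤y to x·y≼y; ∧-greatest to ·-greatest)

  ·-mono : ∀ {x x′ y y′} → x ≼ x′ → y ≼ y′ → x · y ≼ x′ · y′
  ·-mono p q = ·-greatest (≼-trans (x·y≼x _ _) p) (≼-trans (x·y≼y _ _) q)

  ≼-natural : ∀ {x y} → x ≼ y → x ≋ x · y
  ≼-natural p = ·-greatest (≼-refl _) p , x·y≼x _ _

  0#-minimum : ∀ x → 0# ≼ x
  0#-minimum x = ⟪ All.universal
    (λ _ → trans (maximum _) (y≤x∨y _ _) , trans (x∧y≤y _ _) (minimum _)) x ⟫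

  +-complement : ∀ x → 1# ≼ x + - x
  +-complement []            = ⟪ [] ⟫
  +-complement ((u , v) ∷ x) =
    ≡.subst (1# ≼_) (≡.sym (+-distribʳ-· (d + - x) c x))
      (·-greatest
        (≼-trans c+d
          (+-least (x≼x+y c (d + - x)) (≼-trans (x≼x+y d (- x)) (y≼x+y c (d + - x)))))
        (≼-trans (+-complement x)
          (+-least (x≼x+y x (d + - x)) (≼-trans (y≼x+y d (- x)) (y≼x+y x (d + - x))))))
    where
    c d : Fr
    c = (u , v) ∷ []
    d = (⊤ , u) ∷ (v , ⊥) ∷ []

    c+d : 1# ≼ c + d
    c+d = ⟪ trans (x∧y≤x _ _) (y≤x∨y _ _) ∷ trans (x∧y≤y _ _) (x≤x∨y _ _) ∷ [] ⟫

  ·-complement : ∀ x → x · - x ≼ 0#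
  ·-complement []            = ≼-refl 0#
  ·-complement ((u , v) ∷ x) =
    ≼-trans (proj₁ (∧-distribˡ-∨ (c · x) d (- x)))
      (+-least (≼-trans (·-mono (x·y≼x c x) (≼-refl d)) c·d)
               (≼-trans (·-mono (x·y≼y c x) (≼-refl (- x))) (·-complement x)))
    where
    c d : Fr
    c = (u , v) ∷ []
    d = (⊤ , u) ∷ (v , ⊥) ∷ []

    c·d : c · d ≼ 0#
    c·d = ⟪ ( ( ≤⇒Entails ((v , ⊥) ∷ []) (y≤x∨y _ _)
            , ≤⇒Entails ((v , ⊥) ∷ []) (trans (x∧y≤y _ _) (y≤x∨y _ _)))
          , ( ≤⇒Entails ((v , ⊥) ∷ []) (trans (maximum _) (y≤x∨y _ _))
            , trans (trans (x∧y≤x _ _) (x∧y≤y _ _)) (y≤x∨y _ _)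
            , x∧y≤y _ _)) ∷ [] ⟫

  -‿antitone : ∀ {x y} → x ≼ y → - y ≼ - x
  -‿antitone {x} {y} p =
    ≼-trans (·-greatest (≼-refl (- y)) (≼-trans ⟪ [] ⟫ (+-complement x)))
      (≼-trans (proj₁ (∧-distribˡ-∨ (- y) x (- x)))
        (+-least
          (≼-trans (·-greatest (≼-trans (x·y≼y (- y) x) p) (x·y≼x (- y) x))
                   (≼-trans (·-complement y) (0#-minimum (- x))))
          (x·y≼y (- y) (- x))))

  Fr-booleanAlgebra : Alg.BooleanAlgebra 0ℓ 0ℓ
  Fr-booleanAlgebra = record
    { Carrier = Fr ; _≈_ = _≋_ ; _∨_ = _+_ ; _∧_ = _·_ ; ¬_ = -_ ; ⊤ = 1# ; ⊥ = 0#
    ; isBooleanAlgebra = Biased.isBooleanAlgebraʳ record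
      { isDistributiveLattice = isDistributiveLattice
      ; ∨-complementʳ         = λ x → ⟪ [] ⟫ , +-complement x
      ; ∧-complementʳ         = λ x → ·-complement x , 0#-minimum (x · - x)
      ; ¬-cong                = λ (p , q) → -‿antitone q , -‿antitone p
      }
    }

  Entails-interior : ∀ x {s t} → Entails x s t → interior x ∧ s ≤ t
  Entails-interior []            e       = trans (x∧y≤y _ _) e
  Entails-interior ((u , v) ∷ x) (e , f) =
    trans (∧-greatest refl (trans (∧-monotonic (x∧y≤y _ _) refl) (Entails-interior x e)))
      (trans (∧-distribˡ-∨-≤ _ _ _)
        (∨-least (x∧y≤y _ _)
          (trans (∧-greatest (trans (x∧y≤x _ _) (trans (x∧y≤x _ _) (x∧y≤y _ _)))
                   (∧-greatest (trans (x∧y≤x _ _) (x∧y≤y _ _))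
                     (trans (∧-monotonic (trans (x∧y≤x _ _) (x∧y≤x _ _)) refl) ⇨-eval)))
                 (Entails-interior x f))))

  interior-mono : ∀ x {y} → x ≼ y → interior x ≤ interior y
  interior-mono x ⟪ [] ⟫    = maximum _
  interior-mono x ⟪ e ∷ p ⟫ =
    ∧-greatest (transpose-⇨ (Entails-interior x e)) (interior-mono x ⟪ p ⟫)

  interior-· : ∀ x y → interior x ∧ interior y ≤ interior (x · y)
  interior-· []      y = x∧y≤y _ _
  interior-· (c ∷ x) y =
    ∧-greatest (trans (x∧y≤x _ _) (x∧y≤x _ _))
      (trans (∧-monotonic (x∧y≤y _ _) refl) (interior-· x y))

  ι-mono : ∀ {a b} → a ≤ b → ι a ≼ ι b
  ι-mono p = ⟪ (y≤x∨y _ _ , trans (x∧y≤y _ _) p) ∷ [] ⟫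

  ι-reflects-≤ : ∀ {a b} → ι a ≼ ι b → a ≤ b
  ι-reflects-≤ ⟪ (_ , e) ∷ [] ⟫ = trans (∧-greatest (maximum _) refl) e

  ι-∧ : ∀ a b → ι a · ι b ≼ ι (a ∧ b)
  ι-∧ a b = ⟪
    ( (trans (maximum _) (trans (y≤x∨y _ _) (x≤x∨y _ _)) , trans (maximum _) (y≤x∨y _ _))
    , (trans (maximum _) (y≤x∨y _ _) , ∧-monotonic (x∧y≤y _ _) refl)) ∷ [] ⟫

  𝓑-interiorAlgebra : InteriorAlgebra
  𝓑-interiorAlgebra = record
    { booleanAlgebra = Fr-booleanAlgebra
    ; g              = g
    ; g-cong         = λ (p , q) → g-mono p , g-mono q
    ; g-⊤            = ⟪ [] ⟫ , ⟪ refl ∷ [] ⟫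
    ; g-∧            = λ x y →
        ·-greatest (g-mono (x·y≼x x y)) (g-mono (x·y≼y x y)) ,
        ≼-trans (ι-∧ (interior x) (interior y)) (ι-mono (interior-· x y))
    ; g-decreasing   = λ x → ≼-natural (g≼ x)
    ; g-idempotent   = λ x → g≼ (g x) ,
        ι-mono (∧-greatest (transpose-⇨ (x∧y≤x _ _)) (maximum _))
    }
    where
    g-mono : ∀ {x y} → x ≼ y → g x ≼ g y
    g-mono {x} p = ι-mono (interior-mono x p)

    g≼ : ∀ x → g x ≼ x
    g≼ x = ⟪ All.map
      (λ e → trans (maximum _) (y≤x∨y _ _) ,
             trans (∧-greatest (x∧y≤y _ _) (x∧y≤x _ _)) (Entails-interior x e))
      (entails (≼-refl x)) ⟫

  ι-isBoundedLatticeEmbedding :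
    (∀ {a b} → a ≈ b → ι a ≋ ι b) × (∀ {a b} → ι a ≋ ι b → a ≈ b) ×
    (∀ a b → ι (a ∨ b) ≋ ι a + ι b) × (∀ a b → ι (a ∧ b) ≋ ι a · ι b) ×
    ι ⊤ ≋ 1# × ι ⊥ ≋ 0#
  ι-isBoundedLatticeEmbedding =
    (λ p → ι-mono (reflexive p) , ι-mono (reflexive (Eq.sym p))) ,
    (λ (p , q) → antisym (ι-reflects-≤ p) (ι-reflects-≤ q)) ,
    (λ a b → ⟪ (trans (maximum _) (y≤x∨y _ _) , x∧y≤y _ _) ∷ [] ⟫ ,
             ⟪ (trans (∧-greatest refl refl) (y≤x∨y _ _) , x∧y≤y _ _) ∷ [] ⟫) ,
    (λ a b → ·-greatest (ι-mono (x∧y≤x a b)) (ι-mono (x∧y≤y a b)) , ι-∧ a b) ,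
    (⟪ [] ⟫ , ⟪ refl ∷ [] ⟫) ,
    (≼-refl 0# , ≼-refl 0#)

  clause-≋ : ∀ u v → (u , v) ∷ [] ≋ - ι u + ι v
  clause-≋ u v =
    ⟪ ≤⇒Entails ((u , v) ∷ []) (trans (maximum _) (trans (x≤x∨y _ _) (x≤x∨y _ _))) ∷
      (trans (x∧y≤x _ _) (trans (x∧y≤x _ _) (y≤x∨y _ _)) , trans (x∧y≤y _ _) (y≤x∨y _ _)) ∷ [] ⟫ ,
    ⟪ Entails-mono (- ι u + ι v)
        (∧-greatest (∧-greatest refl (maximum _)) (maximum _))
        (∨-least (∨-least (minimum _) (minimum _)) refl)
        (All.head (All.tail (entails (≼-refl (- ι u + ι v))))) ∷ [] ⟫

  -- Every bounded lattice homomorphism from L to a Boolean algebra C extends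
  -- uniquely along ι to a Boolean homomorphism Fr → C.

  module UniversalProperty (C : Alg.BooleanAlgebra ℓ ℓ′) where
    private
      module C where
        open Alg.BooleanAlgebra C public renaming (¬_ to ¬ᶜ_)
        open BooleanProperties C public
        open Lattice ∨-∧-orderTheoreticLattice public
          using (_≤_; x∧y≤x; x∧y≤y; ∧-greatest; x≤x∨y; y≤x∨y; ∨-least; antisym)
          renaming (refl to ≤-refl; reflexive to ≤-reflexive; trans to ≤-trans)
        open MeetProperties (Lattice.meetSemilattice ∨-∧-orderTheoreticLattice) public
          using (∧-monotonic)

    record IsBoundedLatticeHom (f : Carrier → C.Carrier) : Set (ℓ ⊔ ℓ′) where
      field
        cong : ∀ {a b} → a ≈ b → f a C.≈ f b
        ∨-homo : ∀ a b → f (a ∨ b) C.≈ f a C.∨ f b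
        ∧-homo : ∀ a b → f (a ∧ b) C.≈ f a C.∧ f b
        ⊤-homo : f ⊤ C.≈ C.⊤
        ⊥-homo : f ⊥ C.≈ C.⊥

    record IsBooleanHom (h : Fr → C.Carrier) : Set (ℓ ⊔ ℓ′) where
      field
        cong   : ∀ {x y} → x ≋ y → h x C.≈ h y
        +-homo : ∀ x y → h (x + y) C.≈ h x C.∨ h y
        ·-homo : ∀ x y → h (x · y) C.≈ h x C.∧ h y
        -‿homo : ∀ x → h (- x) C.≈ C.¬ᶜ h x
        1-homo : h 1# C.≈ C.⊤
        0-homo : h 0# C.≈ C.⊥

    module _ {f : Carrier → C.Carrier} (f-hom : IsBoundedLatticeHom f) where
      private
        module f = IsBoundedLatticeHom f-hom

      clause : Carrier × Carrier → C.Carrier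
      clause (u , v) = C.¬ᶜ f u C.∨ f v

      extension : Fr → C.Carrier
      extension []      = C.⊤
      extension (c ∷ x) = clause c C.∧ extension x

      private
        open SetoidReasoning C.setoid

        f-mono : ∀ {a b} → a ≤ b → f a C.≤ f b
        f-mono {a} {b} p = begin
          f a         ≈⟨ f.cong (antisym (∧-greatest refl p) (x∧y≤x _ _)) ⟩
          f (a ∧ b)   ≈⟨ f.∧-homo a b ⟩
          f a C.∧ f b ∎

        residuate : ∀ {x a b} → x C.∧ a C.≤ b → x C.≤ C.¬ᶜ a C.∨ b
        residuate {x} {a} {b} p =
          C.≤-trans (C.∧-greatest C.≤-refl
            (C.≤-trans (C.≤-reflexive (C.sym (C.∧-identityʳ x)))
              (C.≤-trans (C.x∧y≤y _ _) (C.≤-reflexive (C.sym (C.∨-complementʳ a))))))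
            (C.≤-trans (C.≤-reflexive (C.∧-distribˡ-∨ x a (C.¬ᶜ a)))
              (C.∨-least (C.≤-trans p (C.y≤x∨y _ _)) (C.≤-trans (C.x∧y≤y _ _) (C.x≤x∨y _ _))))

        evaluate : ∀ a b → (C.¬ᶜ a C.∨ b) C.∧ a C.≤ b
        evaluate a b =
          C.≤-trans (C.≤-reflexive (C.∧-distribʳ-∨ a (C.¬ᶜ a) b))
            (C.∨-least
              (C.≤-trans (C.≤-reflexive (C.∧-complementˡ a)) (C.sym (C.∧-zeroˡ b)))
              (C.x∧y≤x _ _))

        sound : ∀ x {s t} → Entails x s t → extension x C.∧ f s C.≤ f t
        sound []            e       = C.≤-trans (C.x∧y≤y _ _) (f-mono e)
        sound ((u , v) ∷ x) {s} {t} (e , e′) =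
          C.≤-trans
            (C.∧-greatest C.≤-refl
              (C.≤-trans (C.∧-monotonic (C.x∧y≤y _ _) C.≤-refl)
                (C.≤-trans (sound x e) (C.≤-reflexive (f.∨-homo t u)))))
            (C.≤-trans (C.≤-reflexive (C.∧-distribˡ-∨ _ _ _))
              (C.∨-least (C.x∧y≤y _ _)
                (C.≤-trans
                  (C.∧-greatest
                    (C.≤-trans (C.x∧y≤x _ _) (C.≤-trans (C.x∧y≤x _ _) (C.x∧y≤y _ _)))
                    (C.≤-trans
                      (C.∧-greatest (C.≤-trans (C.x∧y≤x _ _) (C.x∧y≤y _ _))
                        (C.≤-trans
                          (C.∧-monotonic (C.≤-trans (C.x∧y≤x _ _) (C.x∧y≤x _ _)) C.≤-refl)
                          (evaluate (f u) (f v))))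
                      (C.≤-reflexive (C.sym (f.∧-homo s v)))))
                  (sound x e′))))

        extension-mono : ∀ x {y} → x ≼ y → extension x C.≤ extension y
        extension-mono x ⟪ [] ⟫    = C.sym (C.∧-identityʳ _)
        extension-mono x ⟪ e ∷ p ⟫ =
          C.∧-greatest (residuate (sound x e)) (extension-mono x ⟪ p ⟫)

        extension-· : ∀ x y → extension (x · y) C.≈ extension x C.∧ extension y
        extension-· []      y = C.sym (C.∧-identityˡ _)
        extension-· (c ∷ x) y =
          C.trans (C.∧-congˡ (extension-· x y)) (C.sym (C.∧-assoc _ _ _))

        clause-∨ : ∀ u v s t → clause (u ∧ s , v ∨ t) C.≈ clause (u , v) C.∨ clause (s , t)
        clause-∨ u v s t = begin
          C.¬ᶜ f (u ∧ s) C.∨ f (v ∨ t)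
            ≈⟨ C.∨-cong (C.trans (C.¬-cong (f.∧-homo u s)) (C.deMorgan₁ _ _)) (f.∨-homo v t) ⟩
          (C.¬ᶜ f u C.∨ C.¬ᶜ f s) C.∨ (f v C.∨ f t)
            ≈⟨ C.∨-assoc _ _ _ ⟩
          C.¬ᶜ f u C.∨ (C.¬ᶜ f s C.∨ (f v C.∨ f t))
            ≈⟨ C.∨-congˡ (C.trans (C.sym (C.∨-assoc _ _ _))
                 (C.trans (C.∨-congʳ (C.∨-comm _ _)) (C.∨-assoc _ _ _))) ⟩
          C.¬ᶜ f u C.∨ (f v C.∨ (C.¬ᶜ f s C.∨ f t))
            ≈⟨ C.∨-assoc _ _ _ ⟨
          clause (u , v) C.∨ clause (s , t) ∎

        extension-map : ∀ u v y → extension (map (λ (s , t) → u ∧ s , v ∨ t) y) C.≈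
                                  clause (u , v) C.∨ extension y
        extension-map u v []            = C.sym (C.∨-zeroʳ _)
        extension-map u v ((s , t) ∷ y) =
          C.trans (C.∧-cong (clause-∨ u v s t) (extension-map u v y))
                  (C.sym (C.∨-distribˡ-∧ _ _ _))

        extension-+ : ∀ x y → extension (x + y) C.≈ extension x C.∨ extension y
        extension-+ []            y = C.sym (C.∨-zeroˡ _)
        extension-+ ((u , v) ∷ x) y = begin
          extension (map _ y ++ (x + y))
            ≈⟨ extension-· (map _ y) (x + y) ⟩
          extension (map _ y) C.∧ extension (x + y)
            ≈⟨ C.∧-cong (extension-map u v y) (extension-+ x y) ⟩
          (clause (u , v) C.∨ extension y) C.∧ (extension x C.∨ extension y)
            ≈⟨ C.∨-distribʳ-∧ _ _ _ ⟨
          (clause (u , v) C.∧ extension x) C.∨ extension y ∎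

        clause-⊤ : ∀ a → clause (⊤ , a) C.≈ f a
        clause-⊤ a = C.trans
          (C.∨-congʳ (C.trans (C.¬-cong f.⊤-homo) C.¬⊤≈⊥)) (C.∨-identityˡ _)

        extension-0 : extension 0# C.≈ C.⊥
        extension-0 = C.trans (C.∧-identityʳ _) (C.trans (clause-⊤ ⊥) f.⊥-homo)

        extension-neg : ∀ x → extension (- x) C.≈ C.¬ᶜ extension x
        extension-neg []            = C.trans extension-0 (C.sym C.¬⊤≈⊥)
        extension-neg ((u , v) ∷ x) = begin
          extension (d + - x)
            ≈⟨ extension-+ d (- x) ⟩
          (clause (⊤ , u) C.∧ (clause (v , ⊥) C.∧ C.⊤)) C.∨ extension (- x)
            ≈⟨ C.∨-cong (C.∧-cong (clause-⊤ u) (C.trans (C.∧-identityʳ _)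
                 (C.trans (C.∨-congˡ f.⊥-homo) (C.∨-identityʳ _)))) (extension-neg x) ⟩
          (f u C.∧ C.¬ᶜ f v) C.∨ C.¬ᶜ extension x
            ≈⟨ C.∨-congʳ (C.∧-congʳ (C.¬-involutive _)) ⟨
          (C.¬ᶜ (C.¬ᶜ f u) C.∧ C.¬ᶜ f v) C.∨ C.¬ᶜ extension x
            ≈⟨ C.∨-congʳ (C.deMorgan₂ _ _) ⟨
          C.¬ᶜ clause (u , v) C.∨ C.¬ᶜ extension x
            ≈⟨ C.deMorgan₁ _ _ ⟨
          C.¬ᶜ extension ((u , v) ∷ x) ∎
          where
          d : Fr
          d = (⊤ , u) ∷ (v , ⊥) ∷ []

      extension-isBooleanHom : IsBooleanHom extension
      extension-isBooleanHom = record
        { cong   = λ {x} {y} (p , q) → C.antisym (extension-mono x p) (extension-mono y q)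
        ; +-homo = extension-+
        ; ·-homo = extension-·
        ; -‿homo = extension-neg
        ; 1-homo = C.refl
        ; 0-homo = extension-0
        }

      extension-ι : ∀ a → extension (ι a) C.≈ f a
      extension-ι a = C.trans (C.∧-identityʳ _) (clause-⊤ a)

      extension-unique : ∀ {h} → IsBooleanHom h → (∀ a → h (ι a) C.≈ f a) →
                         ∀ x → h x C.≈ extension x
      extension-unique h-hom h-ι []            = IsBooleanHom.1-homo h-hom
      extension-unique {h} h-hom h-ι ((u , v) ∷ x) = begin
        h (((u , v) ∷ []) · x)
          ≈⟨ h.·-homo ((u , v) ∷ []) x ⟩
        h ((u , v) ∷ []) C.∧ h x
          ≈⟨ C.∧-cong (C.trans (h.cong (clause-≋ u v)) (C.trans (h.+-homo (- ι u) (ι v))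
               (C.∨-cong (C.trans (h.-‿homo (ι u)) (C.¬-cong (h-ι u))) (h-ι v))))
               (extension-unique h-hom h-ι x) ⟩
        clause (u , v) C.∧ extension x ∎
        where
        module h = IsBooleanHom h-hom

𝓑 : (L : Algebra heytingSignature) → IsHeyting L → Algebra interiorSignature
𝓑 L isHeyting = asAlgebra (FreeBooleanExtension.𝓑-interiorAlgebra (asHeytingAlgebra L isHeyting))

ρ* : (V : Variety heytingSignature) → VarietyOfHeytingAlgebras V → Variety interiorSignature
ρ* V heyting = Generated {I = Σ[ L ∈ Algebra heytingSignature ] L ∈ᵥ V}
                         (λ (L , L∈V) → 𝓑 L (heyting L L∈V))

{-# OPTIONS --safe #-}
module Submission where

-- The functor 𝓑 from V to ρ*(V) is fully faithful and left adjoint to the functor 𝒪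
-- of open elements.  It preserves finitely presented and projective algebras because
-- 𝒪 lands in V (Gödel's translation) and preserves surjections.  Every 𝓑 L satisfies
-- Grzegorczyk's inequality, and a finite interior algebra B that satisfies it is
-- generated by its open elements, so that B ≅ 𝓑 (𝒪 B).  By local finiteness this
-- covers all finitely presented members of ρ*(V), and composing with 𝓑 is an
-- equivalence between the quasiorders of unifiers of L and of 𝓑 L.
--
-- Equality is not decidable here, and a variety has no free algebras in Set.  So a
-- finite presentation of 𝒪 B is not read off its operation tables: it is obtained
-- from one of B, since the equality of two elements of 𝓑 C is a finite conjunction of
-- inequalities in C.

open import Defs
import Algebra.Lattice.Bundles as Alg
import Algebra.Lattice.Properties.BooleanAlgebra as BooleanProperties
import Algebra.Lattice.Structures.Biased as Biased
import Relation.Binary.Lattice.Properties.MeetSemilattice as MeetProperties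
open import Data.Fin.Base using (Fin; zero; suc; toℕ)
open import Data.Fin.Properties using (pigeonhole)
open import Data.List.Base using (List; []; _∷_; _++_; map; concat; tabulate)
open import Data.List.Relation.Unary.All as All using (All; []; _∷_)
open import Data.List.Relation.Unary.All.Properties
  using (++⁺; ++⁻ˡ; ++⁻ʳ; concat⁺; concat⁻; map⁺; map⁻; tabulate⁺; tabulate⁻)
open import Data.Nat.Base using (ℕ; zero; suc; _≤′_; ≤′-refl; ≤′-step)
open import Data.Nat.Properties using (n<1+n; ≤⇒≤′)
open import Data.Product.Base using (Σ-syntax; ∃-syntax; _×_; _,_; proj₁; proj₂)
open import Data.Unit.Base using (tt) renaming (⊤ to Unit)
open import Data.Vec.Functional as Vec using ()
open import Function.Base using (_∘_)
open import Function.Bundles using (_⇔_; mk⇔; Surjection)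
open import Function.Definitions using (StrictlySurjective)
open import Level using (Level)
open import Relation.Binary.Lattice using (HeytingAlgebra; Lattice)
open import Relation.Binary.PropositionalEquality as ≡ using (_≡_)
open import Relation.Binary.Structures using (IsEquivalence)

open Signature
open Hom using (⟦_⟧)

private
  variable
    ℓ : Level
    S : Signature
    A B C : Algebra S
    X : Set

-- Homomorphisms, subalgebras and isomorphisms.

module _ (A : Algebra S) where
  open IsEquivalence (Algebra.isEquivalence A) public
    using () renaming (refl to reflₐ; sym to symₐ; trans to transₐ)

infixr 9 _∘ₕ_

_∘ₕ_ : Hom B C → Hom A B → Hom A C
_∘ₕ_ {C = C} h k = record
  { ⟦_⟧  = ⟦ h ⟧ ∘ ⟦ k ⟧
  ; cong = Hom.cong h ∘ Hom.cong k
  ; homo = λ f xs → transₐ C (Hom.cong h (Hom.homo k f xs)) (Hom.homo h f (⟦ k ⟧ ∘ xs))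
  }

idₕ : Hom A A
idₕ {A = A} = record { ⟦_⟧ = λ x → x ; cong = λ p → p ; homo = λ f xs → reflₐ A }

infix 4 _≗ₕ_

_≗ₕ_ : Hom A B → Hom A B → Set
_≗ₕ_ {B = B} h k = ∀ x → Algebra._≈_ B (⟦ h ⟧ x) (⟦ k ⟧ x)

eval-cong : (A : Algebra S) {ρ σ : X → Algebra.Carrier A} →
            (∀ x → Algebra._≈_ A (ρ x) (σ x)) →
            ∀ t → Algebra._≈_ A (eval A ρ t) (eval A σ t)
eval-cong A p (var x)   = p x
eval-cong A p (op f ts) = Algebra.interp-cong A f (λ i → eval-cong A p (ts i))

hom-eval : (h : Hom A B) (ρ : X → Algebra.Carrier A) →
           ∀ t → Algebra._≈_ B (⟦ h ⟧ (eval A ρ t)) (eval B (⟦ h ⟧ ∘ ρ) t)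
hom-eval {B = B} h ρ (var x)   = reflₐ B
hom-eval {B = B} h ρ (op f ts) = transₐ B (Hom.homo h f _)
  (Algebra.interp-cong B f (λ i → hom-eval h ρ (ts i)))

hom-Holds : (h : Hom A B) {ρ : X → Algebra.Carrier A} {σ : X → Algebra.Carrier B} →
            (∀ x → Algebra._≈_ B (⟦ h ⟧ (ρ x)) (σ x)) →
            ∀ e → Holds A ρ e → Holds B σ e
hom-Holds {A = A} {B = B} h {ρ} {σ} p (s , t) eq =
  transₐ B (symₐ B (image s)) (transₐ B (Hom.cong h eq) (image t))
  where
  image : ∀ t → Algebra._≈_ B (⟦ h ⟧ (eval A ρ t)) (eval B σ t)
  image t = transₐ B (hom-eval h ρ t) (eval-cong B p t)

Injectiveₕ : Hom A B → Set
Injectiveₕ {A = A} {B = B} h =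
  ∀ {x y} → Algebra._≈_ B (⟦ h ⟧ x) (⟦ h ⟧ y) → Algebra._≈_ A x y

hom-Holds⁻ : (h : Hom A B) → Injectiveₕ h → {ρ : X → Algebra.Carrier A} →
             ∀ e → Holds B (⟦ h ⟧ ∘ ρ) e → Holds A ρ e
hom-Holds⁻ {A = A} {B = B} h inj {ρ} (s , t) eq =
  inj (transₐ B (hom-eval h ρ s) (transₐ B eq (symₐ B (hom-eval h ρ t))))

abstract
  subalgebra-∈ᵥ : {W : Variety S} (h : Hom A B) → Injectiveₕ h → B ∈ᵥ W → A ∈ᵥ W
  subalgebra-∈ᵥ h inj B∈W e We ρ = hom-Holds⁻ h inj e (B∈W e We (⟦ h ⟧ ∘ ρ))

-- The laws are checked after `e`, where they are those of `k`; `d` is given as data because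
-- injectivity alone yields no choice of preimages.
factor : (e : Hom B C) → Injectiveₕ e → (k : Hom A C) →
         (d : Algebra.Carrier A → Algebra.Carrier B) →
         (∀ x → Algebra._≈_ C (⟦ e ⟧ (d x)) (⟦ k ⟧ x)) → Hom A B
factor {C = C} e inj k d p = record
  { ⟦_⟧  = d
  ; cong = λ q → inj (transₐ C (p _) (transₐ C (Hom.cong k q) (symₐ C (p _))))
  ; homo = λ f xs → inj (transₐ C (p _) (transₐ C (Hom.homo k f xs)
      (transₐ C (Algebra.interp-cong C f (λ i → symₐ C (p (xs i))))
        (symₐ C (Hom.homo e f (d ∘ xs))))))
  }

infix 4 _≅_

record _≅_ (A B : Algebra S) : Set where
  field
    to      : Hom A B
    from    : Hom B A
    to∘from : to ∘ₕ from ≗ₕ idₕ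
    from∘to : from ∘ₕ to ≗ₕ idₕ

≅-sym : A ≅ B → B ≅ A
≅-sym iso = record { to = from ; from = to ; to∘from = from∘to ; from∘to = to∘from }
  where open _≅_ iso

bijective⇒≅ : (h : Hom A B) → Injectiveₕ h → StrictlySurjective (Algebra._≈_ B) ⟦ h ⟧ → A ≅ B
bijective⇒≅ {B = B} h inj surj = record
  { to      = h
  ; from    = factor h inj idₕ (proj₁ ∘ surj) (proj₂ ∘ surj)
  ; to∘from = proj₂ ∘ surj
  ; from∘to = λ x → inj (proj₂ (surj (⟦ h ⟧ x)))
  }

-- The subalgebra generated by a, with terms as names for its elements: its
-- carrier and operations depend on neither A nor a.

Span : (A : Algebra S) → (X → Algebra.Carrier A) → Algebra S
Span {S = S} {X = X} A a = record
  { Carrier       = Term S X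
  ; _≈_           = λ s t → Holds A a (s , t)
  ; isEquivalence = record { refl = reflₐ A ; sym = symₐ A ; trans = transₐ A }
  ; interp        = op
  ; interp-cong   = λ f → Algebra.interp-cong A f
  }

span-hom : (A : Algebra S) (a : X → Algebra.Carrier A) → Hom (Span A a) A
span-hom A a = record { ⟦_⟧ = eval A a ; cong = λ p → p ; homo = λ f xs → reflₐ A }

Span-∈ᵥ : {W : Variety S} (A : Algebra S) (a : X → Algebra.Carrier A) → A ∈ᵥ W → Span A a ∈ᵥ W
Span-∈ᵥ {W = W} A a = subalgebra-∈ᵥ {W = W} (span-hom A a) (λ p → p)

module _ {W : Variety S} {A : Algebra S} (A∈W : A ∈ᵥ W) (fp : FinitelyPresented W A) where
  open FinitelyPresented fp

  -- The subalgebra of the generators lies in `W` and satisfies the relations, so `A` maps into it.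
  -- Followed by the inclusion this map fixes the generators, hence is the identity, and its value
  -- at `x` is a term for `x`.
  finitelyPresented⇒finitelyGenerated : FinitelyGenerated A
  finitelyPresented⇒finitelyGenerated =
    n , generators ,
    λ x → ⟦ h ⟧ x , extend-unique A A∈W (span-hom A generators ∘ₕ h) idₕ h-generators x
    where
    lift = extend (Span A generators) (Span-∈ᵥ {W = W} A generators A∈W) var
             (All.map (λ {e} eq → hom-Holds⁻ (span-hom A generators) (λ p → p) e eq) generators-satisfy)
    h = proj₁ lift
    h-generators = proj₂ lift

module _ {W : Variety S} {A B : Algebra S} (iso : A ≅ B) where
  open _≅_ iso

  finitelyPresented-resp-≅ : FinitelyPresented W A → FinitelyPresented W B
  finitelyPresented-resp-≅ fp = record
    { n                  = n
    ; relations          = relations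
    ; generators         = ⟦ to ⟧ ∘ generators
    ; generators-satisfy = All.map (λ {e} → hom-Holds to (λ x → reflₐ B) e) generators-satisfy
    ; extend             = λ C C∈W c c-satisfies →
        let h , h-generators = extend C C∈W c c-satisfies
        in h ∘ₕ from ,
           λ i → transₐ C (Hom.cong h (from∘to (generators i))) (h-generators i)
    ; extend-unique      = λ C C∈W h k agree x →
        transₐ C (Hom.cong h (symₐ B (to∘from x)))
          (transₐ C (extend-unique C C∈W (h ∘ₕ to) (k ∘ₕ to) agree (⟦ from ⟧ x))
            (Hom.cong k (to∘from x)))
    }
    where open FinitelyPresented fp

  projective-resp-≅ : Projective W A → Projective W B
  projective-resp-≅ proj C D C∈W D∈W f surj h =
    let k , f∘k = proj C D C∈W D∈W f surj (h ∘ₕ to)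
    in k ∘ₕ from , λ x → transₐ D (f∘k (⟦ from ⟧ x)) (Hom.cong h (to∘from x))

-- Transfer of unification types along equivalences.

≽-trans : {W : Variety S} {U V T : Unifier W A} → U ≽ V → V ≽ T → U ≽ T
≽-trans {T = T} (h , p) (k , q) =
  k ∘ₕ h , λ x → transₐ (Unifier.target T) (q x) (Hom.cong k (p x))

-- The hypotheses say that Φ is an equivalence of quasiorders with pseudoinverse Ψ.

module _ {S′ : Signature} {W : Variety S} {A : Algebra S} {W′ : Variety S′} {A′ : Algebra S′}
         (Φ : Unifier W A → Unifier W′ A′) (Ψ : Unifier W′ A′ → Unifier W A)
         (Φ-mono : ∀ U U′ → U ≽ U′ → Φ U ≽ Φ U′)
         (Φ-reflects : ∀ U U′ → Φ U ≽ Φ U′ → U ≽ U′)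
         (ΦΨ≽ : ∀ U → Φ (Ψ U) ≽ U) (≽ΦΨ : ∀ U → U ≽ Φ (Ψ U)) where

  hasMuSet⇒ : {I : Set ℓ} → HasMuSet W A I → HasMuSet W′ A′ I
  hasMuSet⇒ (m , isMu) = Φ ∘ m , record
    { antichain = λ i j p → antichain i j (Φ-reflects (m i) (m j) p)
    ; dense     = λ U → let i , p = dense (Ψ U) in
        i , ≽-trans {U = Φ (m i)} {Φ (Ψ U)} {U} (Φ-mono (m i) (Ψ U) p) (ΦΨ≽ U)
    }
    where open IsMuSet isMu

  hasMuSet⇐ : {I : Set ℓ} → HasMuSet W′ A′ I → HasMuSet W A I
  hasMuSet⇐ (m , isMu) = Ψ ∘ m , record
    { antichain = λ i j p → antichain i j
        (≽-trans {U = m i} {Φ (Ψ (m i))} {m j} (≽ΦΨ (m i))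
          (≽-trans {U = Φ (Ψ (m i))} {Φ (Ψ (m j))} {m j}
            (Φ-mono (Ψ (m i)) (Ψ (m j)) p) (ΦΨ≽ (m j))))
    ; dense     = λ U → let i , p = dense (Φ U) in
        i , Φ-reflects (Ψ (m i)) U
              (≽-trans {U = Φ (Ψ (m i))} {m i} {Φ U} (ΦΨ≽ (m i)) p)
    }
    where open IsMuSet isMu

  hasType⇔ : ∀ τ → HasType W A τ ⇔ HasType W′ A′ τ
  hasType⇔ τ = mk⇔
    (λ { (is-1 μ)       → is-1 (hasMuSet⇒ μ)
       ; (is-ω n 1<n μ) → is-ω n 1<n (hasMuSet⇒ μ)
       ; (is-∞ I inf μ) → is-∞ I inf (hasMuSet⇒ μ)
       ; (is-0 none)    → is-0 (λ I → none I ∘ hasMuSet⇐)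
       })
    (λ { (is-1 μ)       → is-1 (hasMuSet⇐ μ)
       ; (is-ω n 1<n μ) → is-ω n 1<n (hasMuSet⇐ μ)
       ; (is-∞ I inf μ) → is-∞ I inf (hasMuSet⇐ μ)
       ; (is-0 none)    → is-0 (λ I → none I ∘ hasMuSet⇒)
       })

Member : Variety S → Set₁
Member {S} W = Σ[ A ∈ Algebra S ] A ∈ᵥ W

-- A fully faithful functor F that preserves finitely presented and projective
-- algebras, reflects the latter, and has every finitely presented algebra in its
-- essential image, restricts to an equivalence of the quasiorders of unifiers.

record UnifierEmbedding {S S′ : Signature} (W : Variety S) (W′ : Variety S′) : Set₂ where
  field
    F   : Member W → Algebra S′
    F∈  : ∀ P → F P ∈ᵥ W′
    F₁  : ∀ P Q → Hom (proj₁ P) (proj₁ Q) → Hom (F P) (F Q)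
    F₁⁻ : ∀ P Q → Hom (F P) (F Q) → Hom (proj₁ P) (proj₁ Q)

    F₁-F₁⁻ : ∀ P Q h → F₁ P Q (F₁⁻ P Q h) ≗ₕ h

    F₁-factors  : ∀ P Q R (u : Hom (proj₁ P) (proj₁ Q)) (v : Hom (proj₁ P) (proj₁ R)) h →
                  v ≗ₕ h ∘ₕ u → F₁ P R v ≗ₕ F₁ Q R h ∘ₕ F₁ P Q u
    F₁⁻-factors : ∀ P Q R (u : Hom (proj₁ P) (proj₁ Q)) (v : Hom (proj₁ P) (proj₁ R)) k →
                  F₁ P R v ≗ₕ k ∘ₕ F₁ P Q u → v ≗ₕ F₁⁻ Q R k ∘ₕ u

    finitelyPresented⁺ : ∀ P → FinitelyPresented W (proj₁ P) → FinitelyPresented W′ (F P)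
    projective⁺        : ∀ P → Projective W (proj₁ P) → Projective W′ (F P)
    projective⁻        : ∀ P → Projective W′ (F P) → Projective W (proj₁ P)

    preimage : ∀ B → B ∈ᵥ W′ → FinitelyPresented W′ B →
               Σ[ P ∈ Member W ] F P ≅ B × FinitelyPresented W (proj₁ P)

module _ {S S′ : Signature} {W : Variety S} {W′ : Variety S′}
         (embedding : UnifierEmbedding W W′) (L : Member W) where
  open UnifierEmbedding embedding

  private
    targetₘ : {A : Algebra S} → Unifier W A → Member W
    targetₘ U = Unifier.target U , Unifier.target∈W U

  unifier⁺ : Unifier W (proj₁ L) → Unifier W′ (F L)
  unifier⁺ U = record
    { target            = F (targetₘ U)
    ; target∈W          = F∈ (targetₘ U)
    ; finitelyPresented = finitelyPresented⁺ (targetₘ U) (Unifier.finitelyPresented U)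
    ; projective        = projective⁺ (targetₘ U) (Unifier.projective U)
    ; hom               = F₁ L (targetₘ U) (Unifier.hom U)
    }

  unifier⁺-mono : ∀ U U′ → U ≽ U′ → unifier⁺ U ≽ unifier⁺ U′
  unifier⁺-mono U U′ (h , p) = F₁ (targetₘ U) (targetₘ U′) h , F₁-factors L _ _ _ _ h p

  unifier⁺-reflects : ∀ U U′ → unifier⁺ U ≽ unifier⁺ U′ → U ≽ U′
  unifier⁺-reflects U U′ (k , p) = F₁⁻ (targetₘ U) (targetₘ U′) k , F₁⁻-factors L _ _ _ _ k p

  module _ (U : Unifier W′ (F L)) where
    private
      module U = Unifier U
      P = proj₁ (preimage U.target U.target∈W U.finitelyPresented)
      open _≅_ (proj₁ (proj₂ (preimage U.target U.target∈W U.finitelyPresented)))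

    -- The target is replaced by its preimage `P` and the homomorphism is pulled back by fullness;
    -- the two directions of the isomorphism then compare the result with `U`.
    unifier⁻ : Unifier W (proj₁ L)
    unifier⁻ = record
      { target            = proj₁ P
      ; target∈W          = proj₂ P
      ; finitelyPresented = proj₂ (proj₂ (preimage U.target U.target∈W U.finitelyPresented))
      ; projective        = projective⁻ P (projective-resp-≅ {W = W′}
          (≅-sym (proj₁ (proj₂ (preimage U.target U.target∈W U.finitelyPresented)))) U.projective)
      ; hom               = F₁⁻ L P (from ∘ₕ U.hom)
      }

    unifier⁺-unifier⁻≽ : unifier⁺ unifier⁻ ≽ U
    unifier⁺-unifier⁻≽ = to , λ x → symₐ U.target
      (transₐ U.target (Hom.cong to (F₁-F₁⁻ L P (from ∘ₕ U.hom) x)) (to∘from (⟦ U.hom ⟧ x)))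

    ≽unifier⁺-unifier⁻ : U ≽ unifier⁺ unifier⁻
    ≽unifier⁺-unifier⁻ = from , F₁-F₁⁻ L P (from ∘ₕ U.hom)

  unificationType⇔ : ∀ τ → HasType W (proj₁ L) τ ⇔ HasType W′ (F L) τ
  unificationType⇔ = hasType⇔ unifier⁺ unifier⁻ unifier⁺-mono unifier⁺-reflects
    unifier⁺-unifier⁻≽ ≽unifier⁺-unifier⁻

-- Interior algebras and Grzegorczyk's inequality.

module Interior (K : InteriorAlgebra) where
  open InteriorAlgebra K public
  open Alg.BooleanAlgebra booleanAlgebra public renaming (¬_ to -_)
  open BooleanProperties booleanAlgebra public
    using (∧-identityʳ; ∧-zeroˡ; ∨-∧-orderTheoreticLattice)
  open Lattice ∨-∧-orderTheoreticLattice public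
    using (_≤_; antisym; x∧y≤x; x∧y≤y; ∧-greatest; x≤x∨y; y≤x∨y; ∨-least)
    renaming (refl to ≤-refl; reflexive to ≤-reflexive; trans to ≤-trans)
  open MeetProperties (Lattice.meetSemilattice ∨-∧-orderTheoreticLattice) public
    using (∧-monotonic)

  x≤⊤ : ∀ {x} → x ≤ ⊤
  x≤⊤ = sym (∧-identityʳ _)

  ⊥≤x : ∀ {x} → ⊥ ≤ x
  ⊥≤x = sym (∧-zeroˡ _)

  ∧-split : ∀ {x a b c} → x ∧ a ≤ c → x ∧ b ≤ c → x ∧ (a ∨ b) ≤ c
  ∧-split p q = ≤-trans (≤-reflexive (∧-distribˡ-∨ _ _ _)) (∨-least p q)

  ∧-cases : ∀ {x a c} → x ∧ a ≤ c → x ∧ - a ≤ c → x ≤ c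
  ∧-cases p q = ≤-trans
    (∧-greatest ≤-refl (≤-trans x≤⊤ (≤-reflexive (sym (∨-complementʳ _))))) (∧-split p q)

  contradict : ∀ {x a c} → x ≤ a → x ≤ - a → x ≤ c
  contradict p q = ≤-trans (∧-greatest p q) (≤-trans (≤-reflexive (∧-complementʳ _)) ⊥≤x)

  shunt : ∀ {x a b} → x ∧ a ≤ b → x ≤ - a ∨ b
  shunt p = ∧-cases (≤-trans p (y≤x∨y _ _)) (≤-trans (x∧y≤y _ _) (x≤x∨y _ _))

  unshunt : ∀ {x a b} → x ≤ - a ∨ b → x ∧ a ≤ b
  unshunt p = ≤-trans (∧-greatest (x∧y≤y _ _) (≤-trans (x∧y≤x _ _) p))
    (∧-split (contradict (x∧y≤x _ _) (x∧y≤y _ _)) (x∧y≤y _ _))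

  -‿antitone : ∀ {x y} → x ≤ y → - y ≤ - x
  -‿antitone p =
    ∧-cases (contradict (≤-trans (x∧y≤y _ _) p) (x∧y≤x _ _)) (x∧y≤y _ _)

  g-mono : ∀ {x y} → x ≤ y → g x ≤ g y
  g-mono p = trans (g-cong p) (g-∧ _ _)

  Open : Carrier → Set
  Open x = x ≤ g x

  g-open : ∀ x → Open (g x)
  g-open x = ≤-reflexive (sym (g-idempotent x))

  open-mono : ∀ {x y} → Open x → x ≤ y → x ≤ g y
  open-mono o p = ≤-trans o (g-mono p)

  open⇒g≈ : ∀ {x} → Open x → g x ≈ x
  open⇒g≈ o = antisym (g-decreasing _) o

  ∧-open : ∀ {x y} → Open x → Open y → Open (x ∧ y)
  ∧-open o o′ = ≤-trans (∧-monotonic o o′) (≤-reflexive (sym (g-∧ _ _)))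

  ∨-open : ∀ {x y} → Open x → Open y → Open (x ∨ y)
  ∨-open o o′ = ∨-least (open-mono o (x≤x∨y _ _)) (open-mono o′ (y≤x∨y _ _))

  ⊤-open : Open ⊤
  ⊤-open = ≤-reflexive (sym g-⊤)

  ⊥-open : Open ⊥
  ⊥-open = ⊥≤x

  -- For subsets of a finite poset, with `g` the largest upset inside, `δ y` adds the points whose
  -- successors all lie outside `y` or in its interior, among them every maximal point outside `y`.
  -- Iteration therefore reaches `⊤`.
  δ : Carrier → Carrier
  δ y = y ∨ g (- y ∨ g y)

  -- Grzegorczyk's inequality, relativised to an open element w: this is the form
  -- that passes from a product of clauses to its factors.

  private
    Dense : Carrier → Carrier → Set
    Dense w y = w ∧ g (- y ∨ g y) ≤ y

    -- Below the open element `a` the elements `y` and `y′` agree, hence so do their interiors.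
    dense-restrict : ∀ {w a y y′} → Open a → a ∧ y′ ≤ y → y ≤ y′ →
                     Dense w y → Dense (w ∧ a) y′
    dense-restrict {w} {a} {y} {y′} a-open p q d = ≤-trans
      (∧-greatest (≤-trans (x∧y≤x _ _) (x∧y≤x _ _))
        (≤-trans (∧-monotonic (x∧y≤y _ _) ≤-refl) step))
      (≤-trans d q)
      where
      step : a ∧ g (- y′ ∨ g y′) ≤ g (- y ∨ g y)
      step = open-mono (∧-open a-open (g-open _))
        (≤-trans (∧-monotonic ≤-refl (g-decreasing _))
          (∧-split
            (≤-trans (x∧y≤y _ _) (≤-trans (-‿antitone q) (x≤x∨y _ _)))
            (≤-trans (open-mono (∧-open a-open (g-open _))
                       (≤-trans (∧-monotonic ≤-refl (g-decreasing _)) p))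
                     (y≤x∨y _ _))))

  clause : Carrier × Carrier → Carrier
  clause (u , v) = - u ∨ v

  product : List (Carrier × Carrier) → Carrier
  product []      = ⊤
  product (c ∷ x) = clause c ∧ product x

  private
    -- Induction on the clauses with `w` varying. Below an open element where the first clause
    -- holds, the product agrees with that of the remaining clauses, so the induction hypothesis
    -- applies. This is used first below `v`, where the clause is trivial, and then, once
    -- `w ≤ - u ∨ v` is known, below `w` itself.
    open-≤-product : ∀ x → All (λ (u , v) → Open u × Open v) x →
                     ∀ {w} → Open w → Dense w (product x) → w ≤ product x
    open-≤-product []            []                    o d = x≤⊤
    open-≤-product ((u , v) ∷ x) ((u-open , v-open) ∷ os) {w} o d =
      ∧-greatest w≤clause
        (≤-trans (∧-greatest ≤-refl ≤-refl)
          (open-≤-product x os (∧-open o o)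
            (dense-restrict o (∧-monotonic w≤clause ≤-refl) (x∧y≤y _ _) d)))
      where
      y = product ((u , v) ∷ x)

      wv≤y : w ∧ v ≤ y
      wv≤y = ∧-greatest (≤-trans (x∧y≤y _ _) (y≤x∨y _ _))
        (open-≤-product x os (∧-open o v-open)
          (dense-restrict v-open (∧-monotonic (y≤x∨y _ _) ≤-refl) (x∧y≤y _ _) d))

      -- Below `u` and `y` the first clause yields `v`, and the open element `w ∧ v` lies below `y`.
      wuy≤gy : (w ∧ u) ∧ y ≤ g y
      wuy≤gy = ≤-trans
        (∧-greatest (≤-trans (x∧y≤x _ _) (x∧y≤x _ _))
          (≤-trans (∧-greatest (≤-trans (x∧y≤y _ _) (x∧y≤x _ _))
                               (≤-trans (x∧y≤x _ _) (x∧y≤y _ _)))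
            (unshunt ≤-refl)))
        (open-mono (∧-open o v-open) wv≤y)

      -- The open element `w ∧ u` lies below `- y ∨ g y`, hence below its interior; density puts it
      -- below `y`, and the first clause gives `v`.
      w≤clause : w ≤ - u ∨ v
      w≤clause = shunt (≤-trans
        (∧-greatest
          (≤-trans (∧-greatest (x∧y≤x _ _) (open-mono (∧-open o u-open) (shunt wuy≤gy)))
                   (≤-trans d (x∧y≤x _ _)))
          (x∧y≤y _ _))
        (unshunt ≤-refl))

  -- The premise of Grzegorczyk's axiom `□(□(y → □y) → y) → y`, with `g` for the box.
  grz : Carrier → Carrier
  grz y = g (- g (- y ∨ g y) ∨ y)

  product-grz : ∀ x → All (λ (u , v) → Open u × Open v) x → grz (product x) ≤ product x
  product-grz x os = open-≤-product x os (g-open _)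
    (≤-trans (∧-monotonic (g-decreasing _) ≤-refl) (unshunt ≤-refl))

  module _ (grz≤ : ∀ y → grz y ≤ y) where

    -- If `g (- y ∨ g y)` is below `y`, the element under the outer `g` of `grz y` is `⊤`, so
    -- `⊤ ≤ grz y ≤ y`.
    δ-fixed⇒⊤ : ∀ {y} → δ y ≤ y → y ≈ ⊤
    δ-fixed⇒⊤ {y} p = antisym x≤⊤
      (≤-trans (open-mono ⊤-open (shunt (≤-trans (x∧y≤y _ _) (≤-trans (y≤x∨y _ _) p))))
        (grz≤ y))

  -- Exhibits y as a Boolean combination of δ y and open elements.

  δ-decomposition : ∀ y → y ≈ g y ∨ (δ y ∧ - g (- y ∨ g y))
  δ-decomposition y = antisym
    (∧-cases
      (≤-trans (≤-trans (∧-greatest (≤-trans (x∧y≤y _ _) (g-decreasing _)) (x∧y≤x _ _))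
                        (unshunt ≤-refl)) (x≤x∨y _ _))
      (≤-trans (∧-monotonic (x≤x∨y _ _) ≤-refl) (y≤x∨y _ _)))
    (∨-least (g-decreasing _)
      (≤-trans (∧-greatest (x∧y≤y _ _) (x∧y≤x _ _))
        (∧-split (x∧y≤y _ _) (contradict (x∧y≤y _ _) (x∧y≤x _ _)))))

  module _ {size : ℕ} (e : Fin size → Carrier) (index : Carrier → Fin size)
           (e∘index : ∀ x → e (index x) ≈ x) (grz≤ : ∀ y → grz y ≤ y)
           (Q : Carrier → Set) (Q-resp : ∀ {x y} → x ≈ y → Q x → Q y)
           (Q-⊤ : Q ⊤) (Q-δ : ∀ y → Q (δ y) → Q y) where

    -- y, δ y, δ (δ y), … increases and repeats a value, which by δ-fixed⇒⊤ is ⊤.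

    δ-induction : ∀ y → Q y
    δ-induction y =
      -- There are `suc size` iterates and only `size` indices. The collision of indices avoids any
      -- test for equality of elements.
      let i , j , i<j , same = pigeonhole (n<1+n size) (index ∘ iterate ∘ toℕ)
          yᵢ≈yⱼ = trans (sym (e∘index _)) (trans (reflexive (≡.cong e same)) (e∘index _))
      -- As `i < j` means `suc i ≤ j`, the iterate after the `i`-th lies below the `j`-th, which
      -- equals the `i`-th; so the `i`-th is fixed by `δ`.
      in descend (toℕ i) (Q-resp
           (sym (δ-fixed⇒⊤ grz≤ (≤-trans (iterate-mono (≤⇒≤′ i<j)) (≤-reflexive (sym yᵢ≈yⱼ))))) Q-⊤)
      where
      iterate : ℕ → Carrier
      iterate zero    = y
      iterate (suc n) = δ (iterate n)

      iterate-mono : ∀ {m n} → m ≤′ n → iterate m ≤ iterate n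
      iterate-mono ≤′-refl     = ≤-refl
      iterate-mono (≤′-step p) = ≤-trans (iterate-mono p) (x≤x∨y _ _)

      descend : ∀ n → Q (iterate n) → Q y
      descend zero    q = q
      descend (suc n) q = descend n (Q-δ (iterate n) q)

-- The open elements, presented as the image of g: x stands for g x.

𝒪 : InteriorAlgebra → Algebra heytingSignature
𝒪 K = record
  { Carrier       = Carrier
  ; _≈_           = λ x y → g x ≈ g y
  ; isEquivalence = record { refl = refl ; sym = sym ; trans = trans }
  ; interp        = λ
    { or  xs → g (xs zero) ∨ g (xs (suc zero))
    ; and xs → g (xs zero) ∧ g (xs (suc zero))
    ; imp xs → - g (xs zero) ∨ g (xs (suc zero))
    ; top xs → ⊤
    ; bot xs → ⊥
    }
  ; interp-cong   = λ
    { or  p → g-cong (∨-cong (p zero) (p (suc zero)))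
    ; and p → g-cong (∧-cong (p zero) (p (suc zero)))
    ; imp p → g-cong (∨-cong (¬-cong (p zero)) (p (suc zero)))
    ; top p → refl
    ; bot p → refl
    }
  }
  where
  open Interior K

-- Axioms of interior algebras in a generated variety.

module InteriorOperations (A : Algebra interiorSignature) where
  open Algebra A

  infixr 6 _∨_
  infixr 7 _∧_
  infix  8 -_

  _∨_ _∧_ : Carrier → Carrier → Carrier
  x ∨ y = interp or  (x Vec.∷ y Vec.∷ Vec.[])
  x ∧ y = interp and (x Vec.∷ y Vec.∷ Vec.[])

  -_ g : Carrier → Carrier
  - x = interp neg (x Vec.∷ Vec.[])
  g x = interp int (x Vec.∷ Vec.[])

  ⊤ ⊥ : Carrier
  ⊤ = interp top Vec.[]
  ⊥ = interp bot Vec.[]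

module IdentitiesOf {I : Set₁} (K : I → InteriorAlgebra)
                    (B : Algebra interiorSignature) (B∈ : B ∈ᵥ Generated (asAlgebra ∘ K)) where
  open Algebra B
  open InteriorOperations B

  -- Without function extensionality interp f xs is equal to its value at
  -- the vector of the entries of xs only up to ≈; in flat it is so by definition.

  private
    entries₁ : ∀ {a a′} → a ≈ a′ → ∀ i → (a Vec.∷ Vec.[]) i ≈ (a′ Vec.∷ Vec.[]) i
    entries₁ p zero = p

    entries₂ : ∀ {a a′ b b′} → a ≈ a′ → b ≈ b′ →
               ∀ i → (a Vec.∷ b Vec.∷ Vec.[]) i ≈ (a′ Vec.∷ b′ Vec.∷ Vec.[]) i
    entries₂ p q zero       = p
    entries₂ p q (suc zero) = q

    flat : Algebra interiorSignature
    flat = record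
      { Carrier       = Carrier
      ; _≈_           = _≈_
      ; isEquivalence = isEquivalence
      ; interp        = λ
        { or  xs → xs zero ∨ xs (suc zero)
        ; and xs → xs zero ∧ xs (suc zero)
        ; neg xs → - xs zero
        ; top xs → ⊤
        ; bot xs → ⊥
        ; int xs → g (xs zero)
        }
      ; interp-cong   = λ
        { or  p → interp-cong or  (entries₂ (p zero) (p (suc zero)))
        ; and p → interp-cong and (entries₂ (p zero) (p (suc zero)))
        ; neg p → interp-cong neg (entries₁ (p zero))
        ; top p → reflₐ B
        ; bot p → reflₐ B
        ; int p → interp-cong int (entries₁ (p zero))
        }
      }

    interp-flat : ∀ f xs → interp f xs ≈ Algebra.interp flat f xs
    interp-flat or  xs = interp-cong or  λ { zero → reflₐ B ; (suc zero) → reflₐ B }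
    interp-flat and xs = interp-cong and λ { zero → reflₐ B ; (suc zero) → reflₐ B }
    interp-flat neg xs = interp-cong neg λ { zero → reflₐ B }
    interp-flat top xs = interp-cong top λ ()
    interp-flat bot xs = interp-cong bot λ ()
    interp-flat int xs = interp-cong int λ { zero → reflₐ B }

    flat→B : Hom flat B
    flat→B = record { ⟦_⟧ = λ x → x ; cong = λ p → p ; homo = λ f xs → symₐ B (interp-flat f xs) }

    flat∈ : flat ∈ᵥ Generated (asAlgebra ∘ K)
    flat∈ = subalgebra-∈ᵥ {W = Generated (asAlgebra ∘ K)} flat→B (λ p → p) B∈

    infixr 6 _∨ₜ_
    infixr 7 _∧ₜ_
    infix  8 -ₜ_

    _∨ₜ_ _∧ₜ_ : (s t : Term interiorSignature ℕ) → Term interiorSignature ℕ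
    s ∨ₜ t = op or  (s Vec.∷ t Vec.∷ Vec.[])
    s ∧ₜ t = op and (s Vec.∷ t Vec.∷ Vec.[])

    -ₜ_ gₜ : Term interiorSignature ℕ → Term interiorSignature ℕ
    -ₜ t = op neg (t Vec.∷ Vec.[])
    gₜ t = op int (t Vec.∷ Vec.[])

    ⊤ₜ ⊥ₜ x y z : Term interiorSignature ℕ
    ⊤ₜ = op top Vec.[]
    ⊥ₜ = op bot Vec.[]
    x = var 0
    y = var 1
    z = var 2

    values : Carrier → Carrier → Carrier → ℕ → Carrier
    values a b c 0 = a
    values a b c 1 = b
    values a b c _ = c

    module K i = Interior (K i)

    -- Being valid in every `K i`, the axiom is among the identities of the generated variety.
    -- Axioms in fewer than three variables repeat a value.
    identity : ∀ s t → (∀ i ρ → Holds (asAlgebra (K i)) ρ (s , t)) →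
               ∀ a b c → Holds flat (values a b c) (s , t)
    identity s t valid a b c = flat∈ (s , t) valid (values a b c)

  interiorAlgebra : InteriorAlgebra
  interiorAlgebra = record
    { booleanAlgebra = record
      { isBooleanAlgebra = Biased.isBooleanAlgebraʳ record
        { isDistributiveLattice = Biased.isDistributiveLatticeʳʲᵐ record
          { isLattice    = record
            { isEquivalence = isEquivalence
            ; ∨-comm        = λ a b → identity (x ∨ₜ y) (y ∨ₜ x) (λ i ρ → K.∨-comm i _ _) a b b
            ; ∨-assoc       = identity ((x ∨ₜ y) ∨ₜ z) (x ∨ₜ y ∨ₜ z) (λ i ρ → K.∨-assoc i _ _ _)
            ; ∨-cong        = λ p q → interp-cong or (entries₂ p q)
            ; ∧-comm        = λ a b → identity (x ∧ₜ y) (y ∧ₜ x) (λ i ρ → K.∧-comm i _ _) a b b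
            ; ∧-assoc       = identity ((x ∧ₜ y) ∧ₜ z) (x ∧ₜ y ∧ₜ z) (λ i ρ → K.∧-assoc i _ _ _)
            ; ∧-cong        = λ p q → interp-cong and (entries₂ p q)
            ; absorptive    =
              (λ a b → identity (x ∨ₜ x ∧ₜ y) x (λ i ρ → K.∨-absorbs-∧ i _ _) a b b) ,
              (λ a b → identity (x ∧ₜ (x ∨ₜ y)) x (λ i ρ → K.∧-absorbs-∨ i _ _) a b b)
            }
          ; ∨-distribʳ-∧ = identity (y ∧ₜ z ∨ₜ x) ((y ∨ₜ x) ∧ₜ (z ∨ₜ x))
              (λ i ρ → K.∨-distribʳ-∧ i _ _ _)
          }
        ; ∨-complementʳ         = λ a → identity (x ∨ₜ -ₜ x) ⊤ₜ (λ i ρ → K.∨-complementʳ i _) a a a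
        ; ∧-complementʳ         = λ a → identity (x ∧ₜ -ₜ x) ⊥ₜ (λ i ρ → K.∧-complementʳ i _) a a a
        ; ¬-cong                = λ p → interp-cong neg (entries₁ p)
        }
      }
    ; g            = g
    ; g-cong       = λ p → interp-cong int (entries₁ p)
    ; g-⊤          = identity (gₜ ⊤ₜ) ⊤ₜ (λ i ρ → K.g-⊤ i) ⊤ ⊤ ⊤
    ; g-∧          = λ a b → identity (gₜ (x ∧ₜ y)) (gₜ x ∧ₜ gₜ y) (λ i ρ → K.g-∧ i _ _) a b b
    ; g-decreasing = λ a → identity (gₜ x) (gₜ x ∧ₜ x) (λ i ρ → K.g-decreasing i _) a a a
    ; g-idempotent = λ a → identity (gₜ (gₜ x)) (gₜ x) (λ i ρ → K.g-idempotent i _) a a a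
    }

  flatten : Hom B (asAlgebra interiorAlgebra)
  flatten = record
    { ⟦_⟧  = λ x → x
    ; cong = λ p → p
    ; homo = λ
      { or → interp-flat or ; and → interp-flat and ; neg → interp-flat neg
      ; top → interp-flat top ; bot → interp-flat bot ; int → interp-flat int }
    }

  unflatten : Hom (asAlgebra interiorAlgebra) B
  unflatten = factor flatten (λ p → p) idₕ (λ x → x) (λ x → reflₐ B)

  interiorAlgebra-grz : (∀ i a → Interior._≤_ (K i) (Interior.grz (K i) a) a) →
                        ∀ a → Interior._≤_ interiorAlgebra (Interior.grz interiorAlgebra a) a
  interiorAlgebra-grz valid a = identity t (t ∧ₜ x) (λ i ρ → valid i (ρ 0)) a a a
    where
    t : Term interiorSignature ℕ
    t = gₜ (-ₜ gₜ (-ₜ x ∨ₜ gₜ x) ∨ₜ x)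

-- Gödel's translation and homomorphisms between algebras of open elements.

godel : Term heytingSignature X → Term interiorSignature X
godel (var x)    = op int (var x Vec.∷ Vec.[])
godel (op or ts)  = op or (godel (ts zero) Vec.∷ godel (ts (suc zero)) Vec.∷ Vec.[])
godel (op and ts) = op and (godel (ts zero) Vec.∷ godel (ts (suc zero)) Vec.∷ Vec.[])
godel (op imp ts) =
  op int (op or (op neg (godel (ts zero) Vec.∷ Vec.[]) Vec.∷ godel (ts (suc zero)) Vec.∷ Vec.[])
          Vec.∷ Vec.[])
godel (op top ts) = op top Vec.[]
godel (op bot ts) = op bot Vec.[]

godelₑ : Equation heytingSignature X → Equation interiorSignature X
godelₑ (s , t) = godel s , godel t

module _ (K : InteriorAlgebra) where
  open Interior K

  -- Joins, meets and bounds of open elements are open, so only variables and implications need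
  -- `int` in the translation.
  eval-godel : (ρ : X → Carrier) → ∀ t → g (eval (𝒪 K) ρ t) ≈ eval (asAlgebra K) ρ (godel t)
  eval-godel ρ (var x)     = refl
  eval-godel ρ (op or ts)  = trans (open⇒g≈ (∨-open (g-open _) (g-open _)))
    (∨-cong (eval-godel ρ (ts zero)) (eval-godel ρ (ts (suc zero))))
  eval-godel ρ (op and ts) = trans (open⇒g≈ (∧-open (g-open _) (g-open _)))
    (∧-cong (eval-godel ρ (ts zero)) (eval-godel ρ (ts (suc zero))))
  eval-godel ρ (op imp ts) = g-cong
    (∨-cong (¬-cong (eval-godel ρ (ts zero))) (eval-godel ρ (ts (suc zero))))
  eval-godel ρ (op top ts) = open⇒g≈ ⊤-open
  eval-godel ρ (op bot ts) = open⇒g≈ ⊥-open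

  Holds-godel⁺ : (ρ : X → Carrier) → ∀ e → Holds (𝒪 K) ρ e → Holds (asAlgebra K) ρ (godelₑ e)
  Holds-godel⁺ ρ (s , t) eq = trans (sym (eval-godel ρ s)) (trans eq (eval-godel ρ t))

  Holds-godel⁻ : (ρ : X → Carrier) → ∀ e → Holds (asAlgebra K) ρ (godelₑ e) → Holds (𝒪 K) ρ e
  Holds-godel⁻ ρ (s , t) eq = trans (eval-godel ρ s) (trans eq (sym (eval-godel ρ t)))

-- The function `h` itself serves, without applying `g`: elements stand for their interiors, and `h`
-- commutes with `g`.
𝒪-map : (K K′ : InteriorAlgebra) → Hom (asAlgebra K) (asAlgebra K′) → Hom (𝒪 K) (𝒪 K′)
𝒪-map K K′ h = record
  { ⟦_⟧  = ⟦ h ⟧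
  ; cong = λ p → trans (sym (h-g _)) (trans (Hom.cong h p) (h-g _))
  ; homo = λ
    { or  xs → g-cong
        (trans (Hom.homo h or (K.g (xs zero) Vec.∷ K.g (xs (suc zero)) Vec.∷ Vec.[]))
          (∨-cong (h-g _) (h-g _)))
    ; and xs → g-cong
        (trans (Hom.homo h and (K.g (xs zero) Vec.∷ K.g (xs (suc zero)) Vec.∷ Vec.[]))
          (∧-cong (h-g _) (h-g _)))
    ; imp xs → g-cong
        (trans (Hom.homo h or (K.- K.g (xs zero) Vec.∷ K.g (xs (suc zero)) Vec.∷ Vec.[]))
          (∨-cong (trans (Hom.homo h neg (K.g (xs zero) Vec.∷ Vec.[])) (¬-cong (h-g _))) (h-g _)))
    ; top xs → g-cong (Hom.homo h top Vec.[])
    ; bot xs → g-cong (Hom.homo h bot Vec.[])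
    }
  }
  where
  module K = Interior K
  open Interior K′
  h-g : ∀ x → ⟦ h ⟧ (K.g x) ≈ g (⟦ h ⟧ x)
  h-g x = Hom.homo h int (x Vec.∷ Vec.[])

-- Free Boolean extensions and the adjunction between `𝓑` and `𝒪`.

module Extension (L : Algebra heytingSignature) (isHeyting : IsHeyting L) where
  open FreeBooleanExtension (asHeytingAlgebra L isHeyting) public
  open HeytingAlgebra (asHeytingAlgebra L isHeyting)
    using (_≤_; _⇨_; _∧_; maximum; ∧-greatest; x∧y≤x; transpose-⇨; transpose-∧)
    renaming (antisym to ≤-antisym; reflexive to ≤-reflexive; trans to ≤-trans; refl to ≤-refl)
  open Algebra L using (_≈_; interp; interp-cong) renaming (Carrier to |L|)
  open IsEquivalence ≋-isEquivalence public
    using () renaming (refl to ≋-refl; sym to ≋-sym; trans to ≋-trans)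

  private
    module 𝓘 = Interior 𝓑-interiorAlgebra

  ι-cong : ∀ {a b} → a ≈ b → ι a ≋ ι b
  ι-cong = proj₁ ι-isBoundedLatticeEmbedding

  ι-injective : ∀ {a b} → ι a ≋ ι b → a ≈ b
  ι-injective = proj₁ (proj₂ ι-isBoundedLatticeEmbedding)

  interior-clause : ∀ u v → interior ((u , v) ∷ []) ≈ u ⇨ v
  interior-clause u v = ≤-antisym (x∧y≤x _ _) (∧-greatest ≤-refl (maximum _))

  interior-ι : ∀ a → interior (ι a) ≈ a
  interior-ι a = ≤-antisym
    (≤-trans (≤-reflexive (interior-clause _ a))
      (≤-trans (∧-greatest ≤-refl (maximum _)) (transpose-∧ ≤-refl)))
    (∧-greatest (transpose-⇨ (x∧y≤x _ _)) (maximum _))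

  g-ι : ∀ a → g (ι a) ≋ ι a
  g-ι a = ι-cong (interior-ι a)

  ι-open : ∀ a → 𝓘.Open (ι a)
  ι-open a = 𝓘.≤-reflexive (≋-sym (g-ι a))

  g-clause : ∀ u v → g (- ι u + ι v) ≋ ι (u ⇨ v)
  g-clause u v = ≋-trans (𝓘.g-cong (≋-sym (clause-≋ u v))) (ι-cong (interior-clause u v))

  product-ι : ∀ x → 𝓘.product (map (λ (u , v) → ι u , ι v) x) ≋ x
  product-ι []            = ≋-refl
  product-ι ((u , v) ∷ x) = 𝓘.∧-cong (≋-sym (clause-≋ u v)) (product-ι x)

  -- An element of the free extension is a product of clauses whose entries are open under `ι`, so
  -- `product-grz` applies.
  grz≤ : ∀ x → 𝓘._≤_ (𝓘.grz x) x
  grz≤ x = 𝓘.≤-trans (𝓘.≤-reflexive (grz-cong (≋-sym (product-ι x))))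
    (𝓘.≤-trans (𝓘.product-grz _ (map⁺ (All.universal (λ (u , v) → ι-open u , ι-open v) x)))
      (𝓘.≤-reflexive (product-ι x)))
    where
    grz-cong : ∀ {x y} → x ≋ y → 𝓘.grz x ≋ 𝓘.grz y
    grz-cong p = 𝓘.g-cong (𝓘.∨-cong (𝓘.¬-cong (𝓘.g-cong (𝓘.∨-cong (𝓘.¬-cong p) (𝓘.g-cong p)))) p)

  η : Hom L (𝒪 𝓑-interiorAlgebra)
  η = record
    { ⟦_⟧  = ι
    ; cong = λ p → 𝓘.g-cong (ι-cong p)
    ; homo = λ
      { or xs → 𝓘.g-cong (≋-trans
          (ι-cong (interp-cong or λ { zero → reflₐ L ; (suc zero) → reflₐ L }))
          (≋-trans (proj₁ (proj₂ (proj₂ ι-isBoundedLatticeEmbedding)) (xs zero) (xs (suc zero)))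
            (𝓘.∨-cong (≋-sym (g-ι _)) (≋-sym (g-ι _)))))
      ; and xs → 𝓘.g-cong (≋-trans
          (ι-cong (interp-cong and λ { zero → reflₐ L ; (suc zero) → reflₐ L }))
          (≋-trans (proj₁ (proj₂ (proj₂ (proj₂ ι-isBoundedLatticeEmbedding))) (xs zero) (xs (suc zero)))
            (𝓘.∧-cong (≋-sym (g-ι _)) (≋-sym (g-ι _)))))
      ; imp xs → ≋-trans (g-ι _) (≋-trans
          (ι-cong (interp-cong imp λ { zero → reflₐ L ; (suc zero) → reflₐ L }))
          (≋-trans (≋-sym (g-clause (xs zero) (xs (suc zero))))
            (𝓘.g-cong (𝓘.∨-cong (𝓘.¬-cong (≋-sym (g-ι _))) (≋-sym (g-ι _))))))
      ; top xs → 𝓘.g-cong (≋-trans (ι-cong (interp-cong top λ ()))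
          (proj₁ (proj₂ (proj₂ (proj₂ (proj₂ ι-isBoundedLatticeEmbedding))))))
      ; bot xs → 𝓘.g-cong (≋-trans (ι-cong (interp-cong bot λ ()))
          (proj₂ (proj₂ (proj₂ (proj₂ (proj₂ ι-isBoundedLatticeEmbedding))))))
      }
    }

  η-injective : Injectiveₕ η
  η-injective p = ι-injective (≋-trans (≋-sym (g-ι _)) (≋-trans p (g-ι _)))

  -- The inverse of the unit `η`: `ι (interior x)` is `g x` by definition, and in `𝒪` the element
  -- `x` stands for `g x`.
  interiorₕ : Hom (𝒪 𝓑-interiorAlgebra) L
  interiorₕ = factor η η-injective idₕ interior 𝓘.g-idempotent

  interiorₕ-injective : Injectiveₕ interiorₕ
  interiorₕ-injective = ι-cong

  clauseTerm : Fr → Term interiorSignature |L|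
  clauseTerm []            = op top Vec.[]
  clauseTerm ((u , v) ∷ x) = op and
    (op or (op neg (var u Vec.∷ Vec.[]) Vec.∷ var v Vec.∷ Vec.[]) Vec.∷ clauseTerm x Vec.∷ Vec.[])

  eval-clauseTerm : ∀ x → eval (𝓑 L isHeyting) ι (clauseTerm x) ≋ x
  eval-clauseTerm []            = ≋-refl
  eval-clauseTerm ((u , v) ∷ x) = 𝓘.∧-cong (≋-sym (clause-≋ u v)) (eval-clauseTerm x)

  ∷-cong : ∀ {u u′ v v′ x x′} → u ≈ u′ → v ≈ v′ → x ≋ x′ → (u , v) ∷ x ≋ (u′ , v′) ∷ x′
  ∷-cong p q r = 𝓘.∧-cong
    (≋-trans (clause-≋ _ _)
      (≋-trans (𝓘.∨-cong (𝓘.¬-cong (ι-cong p)) (ι-cong q)) (≋-sym (clause-≋ _ _)))) r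

  -- Clauses write every element as a term over the image of `ι`, and homomorphisms commute with
  -- terms.
  ι-generates : {B : Algebra interiorSignature} (h k : Hom (𝓑 L isHeyting) B) →
                (∀ a → Algebra._≈_ B (⟦ h ⟧ (ι a)) (⟦ k ⟧ (ι a))) → h ≗ₕ k
  ι-generates {B} h k agree x = transₐ B (expand h)
    (transₐ B (eval-cong B agree (clauseTerm x)) (symₐ B (expand k)))
    where
    expand : (h : Hom (𝓑 L isHeyting) B) →
             Algebra._≈_ B (⟦ h ⟧ x) (eval B (⟦ h ⟧ ∘ ι) (clauseTerm x))
    expand h = transₐ B (Hom.cong h (≋-sym (eval-clauseTerm x))) (hom-eval h ι (clauseTerm x))

  module _ (K : InteriorAlgebra) (f : Hom L (𝒪 K)) where
    private
      module K = Interior K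
    open UniversalProperty K.booleanAlgebra

    gf : |L| → K.Carrier
    gf a = K.g (⟦ f ⟧ a)

    gf-isBoundedLatticeHom : IsBoundedLatticeHom gf
    gf-isBoundedLatticeHom = record
      { cong   = Hom.cong f
      ; ∨-homo = λ a b → K.trans (Hom.homo f or _) (K.open⇒g≈ (K.∨-open (K.g-open _) (K.g-open _)))
      ; ∧-homo = λ a b → K.trans (Hom.homo f and _) (K.open⇒g≈ (K.∧-open (K.g-open _) (K.g-open _)))
      ; ⊤-homo = K.trans (Hom.homo f top _) (K.open⇒g≈ K.⊤-open)
      ; ⊥-homo = K.trans (Hom.homo f bot _) (K.open⇒g≈ K.⊥-open)
      }

    open IsBoundedLatticeHom gf-isBoundedLatticeHom

    private
      ext : Fr → K.Carrier
      ext = extension gf-isBoundedLatticeHom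

      module ext = IsBooleanHom (extension-isBooleanHom gf-isBoundedLatticeHom)

      gf-interior : ∀ x → gf (interior x) K.≈ K.g (ext x)
      gf-interior []            = K.trans ⊤-homo (K.sym K.g-⊤)
      gf-interior ((u , v) ∷ x) = K.trans (∧-homo _ _)
        (K.trans (K.∧-cong (Hom.homo f imp _) (gf-interior x)) (K.sym (K.g-∧ _ _)))

    -- The transpose of `f`. The universal property of `Fr` settles the Boolean operations; for
    -- `int`, `f` takes `u ⇨ v` to the interior of the extended clause and `g` preserves meets.
    adjunct : Hom (𝓑 L isHeyting) (asAlgebra K)
    adjunct = record
      { ⟦_⟧  = ext
      ; cong = ext.cong
      ; homo = λ
        { or  xs → ext.+-homo (xs zero) (xs (suc zero))
        ; and xs → ext.·-homo (xs zero) (xs (suc zero))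
        ; neg xs → ext.-‿homo (xs zero)
        ; top xs → ext.1-homo
        ; bot xs → ext.0-homo
        ; int xs → K.trans (extension-ι gf-isBoundedLatticeHom _) (gf-interior (xs zero))
        }
      }

    adjunct-ι : ∀ a → ⟦ adjunct ⟧ (ι a) K.≈ K.g (⟦ f ⟧ a)
    adjunct-ι = extension-ι gf-isBoundedLatticeHom

    module _ (f-injective : Injectiveₕ f) where
      private
        -- Both recursive conditions of `Entails` are forced in a Boolean algebra, since the clause
        -- `- u ∨ v` holds outside `u` and inside `v`. At the empty list an injective lattice
        -- homomorphism reflects `≤`.
        complete : ∀ x {s t} → ext x K.∧ gf s K.≤ gf t → Entails x s t
        complete []            p = f-injective
          (K.trans (K.≤-trans (K.∧-greatest K.x≤⊤ K.≤-refl) p) (K.sym (∧-homo _ _)))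
        complete ((u , v) ∷ x) p =
          complete x (K.≤-trans
            (K.∧-cases (K.≤-trans (K.x∧y≤y _ _) (K.y≤x∨y _ _))
              (K.≤-trans (K.≤-trans
                (K.∧-greatest
                  (K.∧-greatest (K.≤-trans (K.x∧y≤y _ _) (K.x≤x∨y _ _))
                                (K.≤-trans (K.x∧y≤x _ _) (K.x∧y≤x _ _)))
                  (K.≤-trans (K.x∧y≤x _ _) (K.x∧y≤y _ _))) p) (K.x≤x∨y _ _)))
            (K.≤-reflexive (K.sym (∨-homo _ _)))) ,
          complete x (K.≤-trans (K.∧-monotonic K.≤-refl (K.≤-reflexive (∧-homo _ _)))
            (K.≤-trans
              (K.∧-greatest
                (K.∧-greatest (K.≤-trans (K.x∧y≤y _ _) (K.≤-trans (K.x∧y≤y _ _) (K.y≤x∨y _ _)))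
                              (K.x∧y≤x _ _))
                (K.≤-trans (K.x∧y≤y _ _) (K.x∧y≤x _ _))) p))

        reflect : ∀ x y → ext x K.≤ ext y → x ≼ y
        reflect x []            p = ⟪ [] ⟫
        reflect x ((u , v) ∷ y) p = ⟪
          complete x (K.unshunt (K.≤-trans p (K.x∧y≤x _ _))) ∷
          _≼_.entails (reflect x y (K.≤-trans p (K.x∧y≤y _ _))) ⟫

      adjunct-injective : Injectiveₕ adjunct
      adjunct-injective {x} {y} p =
        reflect x y (K.≤-reflexive p) , reflect y x (K.≤-reflexive (K.sym p))

-- The functor `𝓑` from `V` to `ρ* V`.

module _ (V : Variety heytingSignature) (heyting : VarietyOfHeytingAlgebras V) where

  private
    W : Variety interiorSignature
    W = ρ* V heyting

    Memberᵛ Memberʷ : Set₁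
    Memberᵛ = Σ[ L ∈ Algebra heytingSignature ] L ∈ᵥ V
    Memberʷ = Σ[ B ∈ Algebra interiorSignature ] B ∈ᵥ W

    𝓑ᵢ : Memberᵛ → InteriorAlgebra
    𝓑ᵢ (L , L∈V) = FreeBooleanExtension.𝓑-interiorAlgebra (asHeytingAlgebra L (heyting L L∈V))

    𝓑ᵥ : Memberᵛ → Algebra interiorSignature
    𝓑ᵥ (L , L∈V) = 𝓑 L (heyting L L∈V)

    module Ext (L : Memberᵛ) = Extension (proj₁ L) (heyting (proj₁ L) (proj₂ L))
    module Id (B : Memberʷ) = IdentitiesOf 𝓑ᵢ (proj₁ B) (proj₂ B)

    ℐ : Memberʷ → InteriorAlgebra
    ℐ = Id.interiorAlgebra

  𝓑-∈ᵥ : ∀ L → 𝓑ᵥ L ∈ᵥ W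
  𝓑-∈ᵥ L e valid = valid L

  -- `𝒪 (𝓑 L)` embeds in `L` by `interiorₕ` and so satisfies `e`; the translation carries this to
  -- `𝓑 L`.
  godel-valid : ∀ e → V e → W (godelₑ e)
  godel-valid e Ve L ρ = Holds-godel⁺ (𝓑ᵢ L) ρ e
    (subalgebra-∈ᵥ {W = V} (Ext.interiorₕ L) (λ {x} {y} → Ext.interiorₕ-injective L {x} {y})
      (proj₂ L) e Ve ρ)

  module _ (B : Memberʷ) where
    open Id B using (flatten; unflatten)

    asAlgebra-∈ᵥ : asAlgebra (ℐ B) ∈ᵥ W
    asAlgebra-∈ᵥ = subalgebra-∈ᵥ {W = W} unflatten (λ p → p) (proj₂ B)

    𝒪-∈ᵥ : 𝒪 (ℐ B) ∈ᵥ V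
    𝒪-∈ᵥ e Ve ρ = Holds-godel⁻ (ℐ B) ρ e (asAlgebra-∈ᵥ (godelₑ e) (godel-valid e Ve) ρ)

  module _ (P : Memberᵛ) where
    open Ext P

    module _ (Q : Memberᵛ) where
      private
        module Q = Ext Q
        module 𝓑Q = Interior Q.𝓑-interiorAlgebra

      abstract
        up : Hom (proj₁ P) (proj₁ Q) → Hom (𝓑ᵥ P) (𝓑ᵥ Q)
        up h = adjunct Q.𝓑-interiorAlgebra (Q.η ∘ₕ h)

        up-ι : (h : Hom (proj₁ P) (proj₁ Q)) → ∀ a → ⟦ up h ⟧ (ι a) Q.≋ Q.ι (⟦ h ⟧ a)
        up-ι h a = Q.≋-trans (adjunct-ι Q.𝓑-interiorAlgebra (Q.η ∘ₕ h) a) (Q.g-ι _)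

        up-∷ : (h : Hom (proj₁ P) (proj₁ Q)) → ∀ u v x →
               ⟦ up h ⟧ ((u , v) ∷ x) Q.≋ (⟦ h ⟧ u , ⟦ h ⟧ v) ∷ ⟦ up h ⟧ x
        up-∷ h u v x = 𝓑Q.∧-cong
          (Q.≋-trans (𝓑Q.∨-cong (𝓑Q.¬-cong (Q.g-ι _)) (Q.g-ι _)) (Q.≋-sym (Q.clause-≋ _ _)))
          Q.≋-refl

      mapᶠ : (Algebra.Carrier (proj₁ P) → Algebra.Carrier (proj₁ Q)) → Fr → Q.Fr
      mapᶠ f = map (λ (u , v) → f u , f v)

      up-map : (h : Hom (proj₁ P) (proj₁ Q)) → ∀ x → ⟦ up h ⟧ x Q.≋ mapᶠ ⟦ h ⟧ x
      up-map h []            = Hom.homo (up h) top Vec.[]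
      up-map h ((u , v) ∷ x) = Q.≋-trans (up-∷ h u v x)
        (Q.∷-cong (reflₐ (proj₁ Q)) (reflₐ (proj₁ Q)) (up-map h x))

      up-Holds : (h : Hom (proj₁ P) (proj₁ Q)) (ρ : X → Fr) → ∀ r →
                 Holds (𝓑ᵥ P) ρ r → Holds (𝓑ᵥ Q) (mapᶠ ⟦ h ⟧ ∘ ρ) r
      up-Holds h ρ = hom-Holds {A = 𝓑ᵥ P} {B = 𝓑ᵥ Q} (up h) (λ i → up-map h (ρ i))

      up-eval : (h : Hom (proj₁ P) (proj₁ Q)) (ρ : X → Fr) → ∀ t →
                ⟦ up h ⟧ (eval (𝓑ᵥ P) ρ t) Q.≋ eval (𝓑ᵥ Q) (mapᶠ ⟦ h ⟧ ∘ ρ) t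
      up-eval h ρ t = Q.≋-trans (hom-eval {A = 𝓑ᵥ P} {B = 𝓑ᵥ Q} (up h) ρ t)
        (eval-cong (𝓑ᵥ Q) (λ i → up-map h (ρ i)) t)

      up-definition : (h : Hom (proj₁ P) (proj₁ Q)) (ρ : X → Fr) → ∀ t a →
                      eval (𝓑ᵥ P) ρ t ≋ ι a → eval (𝓑ᵥ Q) (mapᶠ ⟦ h ⟧ ∘ ρ) t Q.≋ Q.ι (⟦ h ⟧ a)
      up-definition h ρ t a p = Q.≋-trans (Q.≋-sym (up-eval h ρ t))
        (Q.≋-trans (Hom.cong (up h) p) (up-ι h a))

      up-surjective : (h : Hom (proj₁ P) (proj₁ Q)) →
                      StrictlySurjective (Algebra._≈_ (proj₁ Q)) ⟦ h ⟧ →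
                      StrictlySurjective Q._≋_ ⟦ up h ⟧
      up-surjective h surj []            = [] , Hom.homo (up h) top Vec.[]
      up-surjective h surj ((u , v) ∷ y) with surj u | surj v | up-surjective h surj y
      ... | u′ , p | v′ , q | x , r = (u′ , v′) ∷ x , Q.≋-trans (up-∷ h u′ v′ x) (Q.∷-cong p q r)

      abstract
        down : Hom (𝓑ᵥ P) (𝓑ᵥ Q) → Hom (proj₁ P) (proj₁ Q)
        down h = Q.interiorₕ ∘ₕ 𝒪-map 𝓑-interiorAlgebra Q.𝓑-interiorAlgebra h ∘ₕ η

        -- `ι` after `interior` is `g`, and `⟦ h ⟧ (ι a)` is open because `h` commutes with `g`.
        ι-down : (h : Hom (𝓑ᵥ P) (𝓑ᵥ Q)) → ∀ a → Q.ι (⟦ down h ⟧ a) Q.≋ ⟦ h ⟧ (ι a)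
        ι-down h a = Q.≋-trans (Q.≋-sym (Hom.homo h int (ι a Vec.∷ Vec.[]))) (Hom.cong h (g-ι a))

      up-down : (h : Hom (𝓑ᵥ P) (𝓑ᵥ Q)) → up (down h) ≗ₕ h
      up-down h = ι-generates (up (down h)) h (λ a → Q.≋-trans (up-ι (down h) a) (ι-down h a))

    module _ (B : Memberʷ) where
      open Id B using (flatten; unflatten)
      private
        module I = Interior (ℐ B)

      ♯ : Hom (proj₁ P) (𝒪 (ℐ B)) → Hom (𝓑ᵥ P) (proj₁ B)
      ♯ f = unflatten ∘ₕ adjunct (ℐ B) f

      ♭ : Hom (𝓑ᵥ P) (proj₁ B) → Hom (proj₁ P) (𝒪 (ℐ B))
      ♭ h = 𝒪-map 𝓑-interiorAlgebra (ℐ B) (flatten ∘ₕ h) ∘ₕ η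

      g-♭ : (h : Hom (𝓑ᵥ P) (proj₁ B)) → ∀ a → I.g (⟦ h ⟧ (ι a)) I.≈ ⟦ h ⟧ (ι a)
      g-♭ h a = I.trans (I.sym (Hom.homo (flatten ∘ₕ h) int (ι a Vec.∷ Vec.[]))) (Hom.cong h (g-ι a))

  -- Finite presentations and projectivity under `𝓑`.

  module _ (P : Memberᵛ) where
    open Ext P

    -- By the adjunction, homomorphisms from `𝓑 P` to `B` amount to homomorphisms from `P` to `𝒪 B`,
    -- so the translated relations suffice once the generators are open. The relations `opens`
    -- ensure this; they make the extension hit `b i` and not merely its interior.
    𝓑-finitelyPresented : FinitelyPresented V (proj₁ P) → FinitelyPresented W (𝓑ᵥ P)
    𝓑-finitelyPresented fp = record
      { n                  = n
      ; relations          = map godelₑ relations ++ tabulate opens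
      ; generators         = ι ∘ generators
      ; generators-satisfy = ++⁺
          (map⁺ (All.map (λ {e} eq → Holds-godel⁺ 𝓑-interiorAlgebra (ι ∘ generators) e
                   (hom-Holds η (λ i → ≋-refl) e eq))
                 generators-satisfy))
          (tabulate⁺ (λ i → g-ι (generators i)))
      ; extend             = λ B′ B∈W b b-satisfies →
        let B = B′ , B∈W
            open Id B using (flatten; unflatten)
            module I = Interior (ℐ B)
            satisfies : All (Holds (asAlgebra (ℐ B)) b) (map godelₑ relations ++ tabulate opens)
            satisfies = All.map (λ {e} → hom-Holds flatten (λ i → I.refl) e) b-satisfies
            f , f-generators = extend (𝒪 (ℐ B)) (𝒪-∈ᵥ B) b
              (All.map (λ {e} → Holds-godel⁻ (ℐ B) b e) (map⁻ (++⁻ˡ _ satisfies)))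
        in ♯ P B f , λ i → I.trans (adjunct-ι (ℐ B) f (generators i))
             (I.trans (f-generators i) (tabulate⁻ (++⁻ʳ (map godelₑ relations) satisfies) i))
      ; extend-unique      = λ B′ B∈W h k agree →
        let B = B′ , B∈W
            open Id B using (flatten; unflatten)
            module I = Interior (ℐ B)
        in ι-generates h k (λ a → I.trans (I.sym (g-♭ P B h a))
             (I.trans (extend-unique (𝒪 (ℐ B)) (𝒪-∈ᵥ B) (♭ P B h) (♭ P B k)
                        (λ i → I.g-cong (agree i)) a)
               (g-♭ P B k a)))
      }
      where
      open FinitelyPresented fp
      opens : Fin n → Equation interiorSignature (Fin n)
      opens i = op int (var i Vec.∷ Vec.[]) , var i

    -- The transpose of `h` is lifted along `𝒪 f`, and the lift is transposed back.
    𝓑-projective : Projective V (proj₁ P) → Projective W (𝓑ᵥ P)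
    𝓑-projective proj C D C∈W D∈W f surj h = ♯ P 𝑪 k , ι-generates (f ∘ₕ ♯ P 𝑪 k) h agree
      where
      𝑪 𝑫 : Memberʷ
      𝑪 = C , C∈W
      𝑫 = D , D∈W
      module I = Interior (ℐ 𝑫)

      f′ : Hom (asAlgebra (ℐ 𝑪)) (asAlgebra (ℐ 𝑫))
      f′ = Id.flatten 𝑫 ∘ₕ f ∘ₕ Id.unflatten 𝑪

      lift : Σ[ k ∈ Hom (proj₁ P) (𝒪 (ℐ 𝑪)) ]
               (∀ a → I.g (⟦ f ⟧ (⟦ k ⟧ a)) I.≈ I.g (⟦ h ⟧ (ι a)))
      lift = proj (𝒪 (ℐ 𝑪)) (𝒪 (ℐ 𝑫)) (𝒪-∈ᵥ 𝑪) (𝒪-∈ᵥ 𝑫)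
        (𝒪-map (ℐ 𝑪) (ℐ 𝑫) f′)
        -- Any element of the carrier names an element of `𝒪`, so preimages under `f` serve.
        (λ y → proj₁ (surj y) , I.g-cong (proj₂ (surj y)))
        (♭ P 𝑫 h)

      k : Hom (proj₁ P) (𝒪 (ℐ 𝑪))
      k = proj₁ lift

      agree : ∀ a → ⟦ f ⟧ (⟦ ♯ P 𝑪 k ⟧ (ι a)) I.≈ ⟦ h ⟧ (ι a)
      agree a = I.trans (Hom.cong f (adjunct-ι (ℐ 𝑪) k a))
        (I.trans (Hom.homo f′ int (⟦ k ⟧ a Vec.∷ Vec.[]))
          (I.trans (proj₂ lift a) (g-♭ P 𝑫 h a)))

    -- `up f` is again surjective, so `up h` lifts along it; `down` of the lift is checked after the
    -- injective `ι`.
    projective-of-𝓑 : Projective W (𝓑ᵥ P) → Projective V (proj₁ P)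
    projective-of-𝓑 proj C D C∈V D∈V f surj h =
      let k , f∘k = proj (𝓑ᵥ 𝑪) (𝓑ᵥ 𝑫) (𝓑-∈ᵥ 𝑪) (𝓑-∈ᵥ 𝑫)
                      (up 𝑪 𝑫 f) (up-surjective 𝑪 𝑫 f surj) (up P 𝑫 h)
      in down P 𝑪 k , λ a → 𝑫.ι-injective
           (𝑫.≋-trans (𝑫.≋-sym (up-ι 𝑪 𝑫 f _))
             (𝑫.≋-trans (Hom.cong (up 𝑪 𝑫 f) (ι-down P 𝑪 k a))
               (𝑫.≋-trans (f∘k (ι a)) (up-ι P 𝑫 h a))))
      where
      𝑪 𝑫 : Memberᵛ
      𝑪 = C , C∈V
      𝑫 = D , D∈V
      module 𝑫 = Ext 𝑫

  -- Descent of finite presentations from `𝓑 M` to a finite `M`.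

  -- Over Span C c, Entails and ≋ amount to finitely many identities between terms.

  private
    Clauses : Set → Set
    Clauses X = List (Term heytingSignature X × Term heytingSignature X)

  entailsₑ : Clauses X → (s t : Term heytingSignature X) → List (Equation heytingSignature X)
  entailsₑ []            s t = (s , op and (s Vec.∷ t Vec.∷ Vec.[])) ∷ []
  entailsₑ ((u , v) ∷ x) s t =
    entailsₑ x s (op or (t Vec.∷ u Vec.∷ Vec.[])) ++ entailsₑ x (op and (s Vec.∷ v Vec.∷ Vec.[])) t

  ≼ₑ ≋ₑ : (x y : Clauses X) → List (Equation heytingSignature X)
  ≼ₑ x y = concat (map (λ (s , t) → entailsₑ x s t) y)
  ≋ₑ x y = ≼ₑ x y ++ ≼ₑ y x

  private
    spanᵛ : (C : Memberᵛ) → (X → Algebra.Carrier (proj₁ C)) → Memberᵛ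
    spanᵛ (C , C∈V) c = Span C c , Span-∈ᵥ {W = V} C c C∈V

  module _ (C : Memberᵛ) (c : X → Algebra.Carrier (proj₁ C)) where
    open Ext (spanᵛ C c)

    entailsₑ⁺ : ∀ x {s t} → Entails x s t → All (Holds (proj₁ C) c) (entailsₑ x s t)
    entailsₑ⁺ []            p       = p ∷ []
    entailsₑ⁺ ((u , v) ∷ x) (p , q) = ++⁺ (entailsₑ⁺ x p) (entailsₑ⁺ x q)

    entailsₑ⁻ : ∀ x {s t} → All (Holds (proj₁ C) c) (entailsₑ x s t) → Entails x s t
    entailsₑ⁻ []            (p ∷ []) = p
    entailsₑ⁻ ((u , v) ∷ x) p        =
      entailsₑ⁻ x (++⁻ˡ _ p) , entailsₑ⁻ x (++⁻ʳ (entailsₑ x _ _) p)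

    ≼ₑ⁺ : ∀ x y → x ≼ y → All (Holds (proj₁ C) c) (≼ₑ x y)
    ≼ₑ⁺ x y ⟪ p ⟫ = concat⁺ (map⁺ (All.map (entailsₑ⁺ x) p))

    ≼ₑ⁻ : ∀ x y → All (Holds (proj₁ C) c) (≼ₑ x y) → x ≼ y
    ≼ₑ⁻ x y p = ⟪ All.map (entailsₑ⁻ x) (map⁻ (concat⁻ p)) ⟫

    ≋ₑ⁺ : ∀ x y → x ≋ y → All (Holds (proj₁ C) c) (≋ₑ x y)
    ≋ₑ⁺ x y (p , q) = ++⁺ (≼ₑ⁺ x y p) (≼ₑ⁺ y x q)

    ≋ₑ⁻ : ∀ x y → All (Holds (proj₁ C) c) (≋ₑ x y) → x ≋ y
    ≋ₑ⁻ x y p = ≼ₑ⁻ x y (++⁻ˡ _ p) , ≼ₑ⁻ y x (++⁻ʳ (≼ₑ x y) p)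

  private
    -- Any member of `V` would do, since its span only supplies operations on lists of pairs of
    -- terms; the one-element algebra is always available.
    trivial : Memberᵛ
    trivial = record
      { Carrier       = Unit
      ; _≈_           = λ _ _ → Unit
      ; isEquivalence = record { refl = tt ; sym = λ _ → tt ; trans = λ _ _ → tt }
      ; interp        = λ _ _ → tt
      ; interp-cong   = λ _ _ → tt
      } , λ _ _ _ → tt

    termsᵛ : Set → Memberᵛ
    termsᵛ X = spanᵛ {X = X} trivial (λ _ → tt)

  -- The operations of 𝓑 (Span C c) on lists of pairs of terms do not depend on c,
  -- so that values of interior terms can be computed before C and c are known.

  module _ (C : Memberᵛ) (c : X → Algebra.Carrier (proj₁ C)) where
    private
      module 𝒞 = Ext (spanᵛ C c)
      module 𝒯 = Ext (termsᵛ X)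

    -- `-` and `interior` recurse on the list, so agreement on an unknown list takes induction; `+`
    -- and `·` agree by definition.
    -‿uniform : ∀ x → 𝒞.- x ≡ 𝒯.- x
    -‿uniform []            = ≡.refl
    -‿uniform ((u , v) ∷ x) =
      ≡.cong (((op top Vec.[] , u) ∷ (v , op bot Vec.[]) ∷ []) 𝒯.+_) (-‿uniform x)

    interior-uniform : ∀ x → 𝒞.interior x ≡ 𝒯.interior x
    interior-uniform []            = ≡.refl
    interior-uniform ((u , v) ∷ x) =
      ≡.cong (λ t → op and (op imp (u Vec.∷ v Vec.∷ Vec.[]) Vec.∷ t Vec.∷ Vec.[])) (interior-uniform x)

    eval-uniform : {Y : Set} (β : Y → Clauses X) → ∀ t →
                   eval (𝓑ᵥ (spanᵛ C c)) β t ≡ eval (𝓑ᵥ (termsᵛ X)) β t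
    eval-uniform β (var y)     = ≡.refl
    eval-uniform β (op or ts)  =
      ≡.cong₂ 𝒯._+_ (eval-uniform β (ts zero)) (eval-uniform β (ts (suc zero)))
    eval-uniform β (op and ts) =
      ≡.cong₂ _++_ (eval-uniform β (ts zero)) (eval-uniform β (ts (suc zero)))
    eval-uniform β (op neg ts) = ≡.trans (-‿uniform (eval (𝓑ᵥ (spanᵛ C c)) β (ts zero)))
      (≡.cong 𝒯.-_ (eval-uniform β (ts zero)))
    eval-uniform β (op top ts) = ≡.refl
    eval-uniform β (op bot ts) = ≡.refl
    eval-uniform β (op int ts) = ≡.cong 𝒯.ι
      (≡.trans (interior-uniform (eval (𝓑ᵥ (spanᵛ C c)) β (ts zero)))
        (≡.cong 𝒯.interior (eval-uniform β (ts zero))))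

  module _ (M : Memberᵛ) (fp : FinitelyPresented W (𝓑ᵥ M)) (size : ℕ)
           (e : Fin size → Algebra.Carrier (proj₁ M)) (index : Algebra.Carrier (proj₁ M) → Fin size)
           (e∘index : ∀ x → Algebra._≈_ (proj₁ M) (e (index x)) x) where
    private
      module M = Ext M
      open FinitelyPresented fp
      open Algebra (proj₁ M) using () renaming (Carrier to |M|)

      name : |M| → Term heytingSignature (Fin size)
      name = var ∘ index

      β : Fin n → Clauses (Fin size)
      β i = map (λ (u , v) → name u , name v) (generators i)

      generated : ∀ x → ∃[ t ] eval (𝓑ᵥ M) generators t M.≋ x
      generated = proj₂ (proj₂ (finitelyPresented⇒finitelyGenerated {W = W} (𝓑-∈ᵥ M) fp))

      q : Fin size → Term interiorSignature (Fin n)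
      q j = proj₁ (generated (M.ι (e j)))

      eval-q : ∀ j → eval (𝓑ᵥ M) generators (q j) M.≋ M.ι (e j)
      eval-q j = proj₂ (generated (M.ι (e j)))

      value : Term interiorSignature (Fin n) → Clauses (Fin size)
      value = eval (𝓑ᵥ (termsᵛ (Fin size))) β

      ιvar : Fin size → Clauses (Fin size)
      ιvar j = (op top Vec.[] , var j) ∷ []

      relation : Equation interiorSignature (Fin n) → List (Equation heytingSignature (Fin size))
      relation (s , t) = ≋ₑ (value s) (value t)

      definition : Fin size → List (Equation heytingSignature (Fin size))
      definition j = ≋ₑ (value (q j)) (ιvar j)

      -- All elements of `M` serve as generators. The relations of `𝓑 M` become equations in their
      -- names, and `definition j` ties the term `q j` for `ι (e j)` to the generator `j`.
      relationsᴹ : List (Equation heytingSignature (Fin size))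
      relationsᴹ = concat (map relation relations) ++ concat (tabulate definition)

      module _ (C : Memberᵛ) (c : Fin size → Algebra.Carrier (proj₁ C)) where
        private
          module 𝒞 = Ext (spanᵛ C c)
          𝓑𝒞 = 𝓑ᵥ (spanᵛ C c)

        relations⁺ : All (Holds 𝓑𝒞 β) relations → (∀ j → eval 𝓑𝒞 β (q j) 𝒞.≋ ιvar j) →
                     All (Holds (proj₁ C) c) relationsᴹ
        relations⁺ p d = ++⁺
          (concat⁺ (map⁺ (All.map (λ {(s , t)} r → ≋ₑ⁺ C c _ _
            (≡.subst₂ 𝒞._≋_ (eval-uniform C c β s) (eval-uniform C c β t) r)) p)))
          (concat⁺ (tabulate⁺ (λ j → ≋ₑ⁺ C c _ _
            (≡.subst (𝒞._≋ ιvar j) (eval-uniform C c β (q j)) (d j)))))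

        relations⁻ : All (Holds (proj₁ C) c) relationsᴹ →
                     All (Holds 𝓑𝒞 β) relations × (∀ j → eval 𝓑𝒞 β (q j) 𝒞.≋ ιvar j)
        relations⁻ p =
          All.map (λ {(s , t)} r →
              ≡.subst₂ 𝒞._≋_ (≡.sym (eval-uniform C c β s)) (≡.sym (eval-uniform C c β t)) (≋ₑ⁻ C c _ _ r))
            (map⁻ (concat⁻ (++⁻ˡ _ p))) ,
          λ j → ≡.subst (𝒞._≋ ιvar j) (≡.sym (eval-uniform C c β (q j)))
            (≋ₑ⁻ C c _ _ (tabulate⁻ (concat⁻ {xss = tabulate definition}
              (++⁻ʳ (concat (map relation relations)) p)) j))

      module 𝑺 = Ext (spanᵛ M e)

      σ : Hom (proj₁ M) (proj₁ (spanᵛ M e))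
      σ = factor (span-hom (proj₁ M) e) (λ p → p) idₕ name e∘index

      σ-satisfies : ∀ r → Holds (𝓑ᵥ M) generators r → Holds (𝓑ᵥ (spanᵛ M e)) β r
      σ-satisfies = up-Holds M (spanᵛ M e) σ generators

      σ-defines : ∀ j → eval (𝓑ᵥ (spanᵛ M e)) β (q j) 𝑺.≋ ιvar j
      σ-defines j = 𝑺.≋-trans
        (up-definition M (spanᵛ M e) σ generators (q j) (e j) (eval-q j))
        (𝑺.ι-cong (e∘index (e j)))

    -- In `𝓑 (Span C c)` the lists `β` satisfy the relations of `𝓑 M`; `down` of the induced
    -- homomorphism, followed by evaluation in `C`, is the extension. Uniqueness is immediate
    -- because every element is a generator.
    finitelyPresented-of-𝓑 : FinitelyPresented V (proj₁ M)
    finitelyPresented-of-𝓑 = record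
      { n                  = size
      ; relations          = relationsᴹ
      ; generators         = e
      ; generators-satisfy = relations⁺ M e
          (All.map (λ {r} → σ-satisfies r) generators-satisfy) σ-defines
      ; extend             = λ C C∈V c c-satisfies → extendᴹ (C , C∈V) c c-satisfies
      ; extend-unique      = λ C C∈V h k agree x →
          transₐ C (Hom.cong h (symₐ (proj₁ M) (e∘index x)))
            (transₐ C (agree (index x)) (Hom.cong k (e∘index x)))
      }
      where
      extendᴹ : (C : Memberᵛ) (c : Fin size → Algebra.Carrier (proj₁ C)) →
                All (Holds (proj₁ C) c) relationsᴹ →
                Σ[ h ∈ Hom (proj₁ M) (proj₁ C) ] (∀ j → Algebra._≈_ (proj₁ C) (⟦ h ⟧ (e j)) (c j))
      -- The definitions force `e j` to go to `c j`: the image of `ι (e j)` under `h` is the value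
      -- of `q j` at `β`, which they equate with `ιvar j`.
      extendᴹ C c c-satisfies = span-hom (proj₁ C) c ∘ₕ down M (spanᵛ C c) h , λ j →
          𝒞.ι-injective (𝒞.≋-trans (ι-down M (spanᵛ C c) h (e j))
            (𝒞.≋-trans (Hom.cong h (M.≋-sym (eval-q j)))
              (𝒞.≋-trans (hom-eval h generators (q j))
                (𝒞.≋-trans (eval-cong (𝓑ᵥ (spanᵛ C c)) h-generators (q j)) (proj₂ satisfied j)))))
        where
        module 𝒞 = Ext (spanᵛ C c)
        satisfied = relations⁻ C c c-satisfies
        lift = extend (𝓑ᵥ (spanᵛ C c)) (𝓑-∈ᵥ (spanᵛ C c)) β (proj₁ satisfied)
        h = proj₁ lift
        h-generators = proj₂ lift

  -- The counit on finite interior algebras, and the embedding.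

  private
    𝒪ᵛ : Memberʷ → Memberᵛ
    𝒪ᵛ B = 𝒪 (ℐ B) , 𝒪-∈ᵥ B

  module _ (B : Memberʷ) {size : ℕ}
           (e : Fin size → Algebra.Carrier (proj₁ B)) (index : Algebra.Carrier (proj₁ B) → Fin size)
           (e∘index : ∀ x → Algebra._≈_ (proj₁ B) (e (index x)) x) where
    private
      module I = Interior (ℐ B)

      module M = Ext (𝒪ᵛ B)

      -- The counit of the adjunction; `ε♭` is the same map into the flattened algebra.
      ε : Hom (𝓑ᵥ (𝒪ᵛ B)) (proj₁ B)
      ε = ♯ (𝒪ᵛ B) B idₕ

      ε♭ : Hom (𝓑ᵥ (𝒪ᵛ B)) (asAlgebra (ℐ B))
      ε♭ = M.adjunct (ℐ B) idₕ

      ε-ι : ∀ x → ⟦ ε ⟧ (M.ι x) I.≈ I.g x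
      ε-ι = M.adjunct-ι (ℐ B) idₕ

      -- The image contains the open elements and is closed under the Boolean operations, so by
      -- `δ-decomposition` it contains `y` along with `δ y`.
      ε-surjective : StrictlySurjective I._≈_ ⟦ ε ⟧
      ε-surjective = I.δ-induction e index e∘index
        (Id.interiorAlgebra-grz B (λ L → Ext.grz≤ L))
        (λ y → ∃[ x ] ⟦ ε ⟧ x I.≈ y)
        (λ p (x , q) → x , I.trans q p)
        (M.1# , Hom.homo ε♭ top Vec.[])
        (λ y (x , p) →
          M.ι y M.+ (x M.· (M.- M.ι (I.- y I.∨ I.g y))) ,
          I.trans (Hom.homo ε♭ or (M.ι y Vec.∷ (x M.· (M.- M.ι (I.- y I.∨ I.g y))) Vec.∷ Vec.[]))
            (I.trans
              (I.∨-cong (ε-ι y)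
                (I.trans (Hom.homo ε♭ and (x Vec.∷ (M.- M.ι (I.- y I.∨ I.g y)) Vec.∷ Vec.[]))
                  (I.∧-cong p
                    (I.trans (Hom.homo ε♭ neg (M.ι (I.- y I.∨ I.g y) Vec.∷ Vec.[]))
                      (I.¬-cong (ε-ι (I.- y I.∨ I.g y)))))))
              (I.sym (I.δ-decomposition y))))

      ε-injective : ∀ {x y} → ⟦ ε♭ ⟧ x I.≈ ⟦ ε♭ ⟧ y → x M.≋ y
      ε-injective = M.adjunct-injective (ℐ B) idₕ (λ p → p)

    𝓑𝒪≅ : 𝓑ᵥ (𝒪ᵛ B) ≅ proj₁ B
    𝓑𝒪≅ = bijective⇒≅ ε ε-injective ε-surjective

  module _ (L P Q : Memberᵛ) (u : Hom (proj₁ L) (proj₁ P)) (v : Hom (proj₁ L) (proj₁ Q)) where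
    private
      module L = Ext L
      module P = Ext P
      module Q = Ext Q

    up-factors : (h : Hom (proj₁ P) (proj₁ Q)) →
                 (∀ a → Algebra._≈_ (proj₁ Q) (⟦ v ⟧ a) (⟦ h ⟧ (⟦ u ⟧ a))) →
                 ∀ x → ⟦ up L Q v ⟧ x Q.≋ ⟦ up P Q h ⟧ (⟦ up L P u ⟧ x)
    up-factors h p = L.ι-generates (up L Q v) (up P Q h ∘ₕ up L P u) λ a →
      Q.≋-trans (up-ι L Q v a) (Q.≋-trans (Q.ι-cong (p a))
        (Q.≋-trans (Q.≋-sym (up-ι P Q h _)) (Hom.cong (up P Q h) (P.≋-sym (up-ι L P u a)))))

    down-factors : (k : Hom (𝓑ᵥ P) (𝓑ᵥ Q)) →
                   (∀ x → ⟦ up L Q v ⟧ x Q.≋ ⟦ k ⟧ (⟦ up L P u ⟧ x)) →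
                   ∀ a → Algebra._≈_ (proj₁ Q) (⟦ v ⟧ a) (⟦ down P Q k ⟧ (⟦ u ⟧ a))
    down-factors k p a = Q.ι-injective
      (Q.≋-trans (Q.≋-sym (up-ι L Q v a)) (Q.≋-trans (p _)
        (Q.≋-trans (Hom.cong k (up-ι L P u a)) (Q.≋-sym (ι-down P Q k _)))))

  module _ (locallyFinite : LocallyFinite W) (B : Algebra interiorSignature) (B∈W : B ∈ᵥ W)
           (fp : FinitelyPresented W B) where
    private
      finite : Finite (Algebra.setoid B)
      finite = locallyFinite B B∈W (finitelyPresented⇒finitelyGenerated {W = W} B∈W fp)

      open Surjection (proj₂ finite) using () renaming (to to e; to⁻ to index; to∘to⁻ to e∘index)

      iso : 𝓑ᵥ (𝒪ᵛ (B , B∈W)) ≅ B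
      iso = 𝓑𝒪≅ (B , B∈W) e index e∘index

    𝓑-preimage : Σ[ M ∈ Memberᵛ ] 𝓑ᵥ M ≅ B × FinitelyPresented V (proj₁ M)
    𝓑-preimage = 𝒪ᵛ (B , B∈W) , iso ,
      finitelyPresented-of-𝓑 (𝒪ᵛ (B , B∈W)) (finitelyPresented-resp-≅ {W = W} (≅-sym iso) fp)
        -- `𝒪 B` has the carrier of `B` and a coarser equality, so an enumeration of `B` also
        -- enumerates it.
        (proj₁ finite) e index (λ x → Interior.g-cong (ℐ (B , B∈W)) (e∘index x))

  𝓑-embedding : LocallyFinite W → UnifierEmbedding V W
  𝓑-embedding locallyFinite = record
    { F                  = 𝓑ᵥ
    ; F∈                 = 𝓑-∈ᵥ
    ; F₁                 = up
    ; F₁⁻                = down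
    ; F₁-F₁⁻             = up-down
    ; F₁-factors         = up-factors
    ; F₁⁻-factors        = down-factors
    ; finitelyPresented⁺ = 𝓑-finitelyPresented
    ; projective⁺        = 𝓑-projective
    ; projective⁻        = projective-of-𝓑
    ; preimage           = 𝓑-preimage locallyFinite
    }

theorem5p7 : (V : Variety heytingSignature) (heyting : VarietyOfHeytingAlgebras V) →
    LocallyFinite (ρ* V heyting) →
    ∀ L (L∈V : L ∈ᵥ V) (τ : UnificationType) →
    HasType V L τ ⇔ HasType (ρ* V heyting) (𝓑 L (heyting L L∈V)) τ
theorem5p7 V heyting locallyFinite L L∈V =
  unificationType⇔ (𝓑-embedding V heyting locallyFinite) (L , L∈V)
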